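{- Let $\mathcal{A}$ be any deterministic algorithm which takes as input a function $g:\mathbb{R}^d\to\mathbb{R}$, accesses $g$ only through zeroth-, first- and second-order oracle queries (values of $g$, $\nabla g$, $\nabla^2 g$ at query points), and outputs a single point $\tilde x(g)\in\mathbb{R}^d$. Then there exists a function $\mathfrak{f}:\mathbb{R}^d\to\mathbb{R}$ that is $1$-Lipschitz, has $8$-Lipschitz gradient, satisfies $\sup_x\mathfrak{f}(x)-\inf_x\mathfrak{f}(x)\le\frac1e$, and has a global minimizer $x^\star\in B(0,10)$, such that $\mathcal{A}(\mathfrak{f})$ must make at least $2^d$ oracle calls to find an $\epsilon$-global minimizer $x^\circ$ of $\mathfrak{f}$ with $\epsilon=\frac{1}{2e}$, i.e. a point with $\mathfrak{f}(x^\circ)-\mathfrak{f}(x^\star)\le\epsilon$.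
   Context: $B(c,r)$ denotes the closed Euclidean ball of radius $r$ centered at $c$. -}

module Defs where

open import Algebra.Bundles using (CommutativeRing)
open import Algebra.Core using (Op₁; Op₂)
open import Algebra.Structures using (IsCommutativeRing)
open import Data.List.Base using (List; []; _∷_)
open import Data.Nat.Base as ℕ using (ℕ; zero; suc; _!)
import Data.Nat.Properties as ℕ
open import Data.Product.Base using (∃; _,_; proj₁; proj₂) renaming (_×_ to _∧_)
open import Data.Product.Relation.Binary.Pointwise.NonDependent using (_×ₛ_)
open import Data.Sum.Base using (_⊎_; inj₁; inj₂)
open import Data.Sum.Relation.Binary.Pointwise using (_⊎ₛ_)
open import Data.Vec.Functional using (Vector; zipWith; replicate)
import Data.List.Relation.Binary.Pointwise as ListPointwise
import Data.Vec.Functional.Relation.Binary.Equality.Setoid as VectorEquality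
open import Function.Bundles using (Func)
open import Level using (0ℓ)
open import Relation.Binary.Bundles using (Setoid; TotalOrder)
open import Relation.Binary.Core using (Rel)
open import Relation.Binary.PropositionalEquality.Core as ≡ using (_≡_)
open import Relation.Binary.Structures using (IsTotalOrder)
open import Relation.Nullary.Negation using (¬_; contradiction)
open import Relation.Unary using (Pred; _∈_)

import Algebra.Construct.NaturalChoice.Max as NaturalMax
import Algebra.Properties.Monoid.Mult as MonoidMult
import Algebra.Properties.Monoid.Sum as MonoidSum
import Algebra.Properties.Ring as RingProperties
import Relation.Binary.Construct.NonStrictToStrict as NonStrictToStrict
import Relation.Binary.Reasoning.PartialOrder as PartialOrderReasoning

------------------------------------------------------------------------
-- The real numbers: complete ordered fields
------------------------------------------------------------------------

module _ {A : Set} (_≤_ : Rel A 0ℓ) where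

  UpperBound LowerBound : Pred A 0ℓ → Pred A 0ℓ
  UpperBound P b = ∀ x → x ∈ P → x ≤ b
  LowerBound P b = ∀ x → x ∈ P → b ≤ x

  IsSup IsInf : Pred A 0ℓ → Pred A 0ℓ
  IsSup P s = UpperBound P s ∧ (∀ b → UpperBound P b → s ≤ b)
  IsInf P s = LowerBound P s ∧ (∀ b → LowerBound P b → b ≤ s)

-- Classically these axioms determine ℝ up to isomorphism.  The inverse is
-- total, but nothing is assumed about the value of 0# ⁻¹.

record CompleteOrderedField : Set₁ where
  infix  8 _⁻¹
  infix  8 -_
  infixl 7 _*_
  infixl 6 _+_
  infix  4 _≈_ _≤_
  field
    Carrier           : Set
    _≈_ _≤_           : Rel Carrier 0ℓ
    _+_ _*_           : Op₂ Carrier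
    -_ _⁻¹            : Op₁ Carrier
    0# 1#             : Carrier
    isCommutativeRing : IsCommutativeRing _≈_ _+_ _*_ -_ 0# 1#
    isTotalOrder      : IsTotalOrder _≈_ _≤_
    0≉1               : ¬ 0# ≈ 1#
    ⁻¹-inverseʳ       : ∀ x → ¬ x ≈ 0# → x * x ⁻¹ ≈ 1#
    +-monoˡ-≤         : ∀ z {x y} → x ≤ y → x + z ≤ y + z
    *-nonNegative     : ∀ {x y} → 0# ≤ x → 0# ≤ y → 0# ≤ x * y
    complete          : (P : Pred Carrier 0ℓ) → ∃ P → ∃ (UpperBound _≤_ P) →
                        ∃ (IsSup _≤_ P)

  commutativeRing : CommutativeRing 0ℓ 0ℓ
  commutativeRing = record { isCommutativeRing = isCommutativeRing }

  totalOrder : TotalOrder 0ℓ 0ℓ 0ℓ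
  totalOrder = record { isTotalOrder = isTotalOrder }

module Reals (R : CompleteOrderedField) where

  open CompleteOrderedField R public
    using (0≉1; _⁻¹; ⁻¹-inverseʳ; +-monoˡ-≤; *-nonNegative; complete; commutativeRing; totalOrder)
  open CommutativeRing commutativeRing public
    using (_≈_; _+_; _*_; -_; _-_; 0#; 1#; setoid)
    renaming (Carrier to ℝ)
  open TotalOrder totalOrder public using (_≤_)
  open NonStrictToStrict _≈_ _≤_ public using (_<_)
  open NaturalMax totalOrder public using (_⊔_)
  open MonoidMult (CommutativeRing.+-monoid commutativeRing) public using (_×_)
  open MonoidSum (CommutativeRing.+-monoid commutativeRing) public using (sum)

  fromℕ : ℕ → ℝ
  fromℕ n = n × 1#

  ∣_∣ : ℝ → ℝ
  ∣ x ∣ = x ⊔ - x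

  module OrderLemmas where

    private
      module K = CommutativeRing commutativeRing
      module T = TotalOrder totalOrder
      module M = MonoidMult K.+-monoid
    open RingProperties K.ring using (-‿distribˡ-*; -‿distribʳ-*; -‿involutive)
    open PartialOrderReasoning T.poset

    +-monoʳ : ∀ z {x y} → x ≤ y → z + x ≤ z + y
    +-monoʳ z {x} {y} x≤y = begin
      z + x  ≈⟨ K.+-comm z x ⟩
      x + z  ≤⟨ +-monoˡ-≤ z x≤y ⟩
      y + z  ≈⟨ K.+-comm y z ⟩
      z + y  ∎

    x≤y⇒0≤y-x : ∀ {x y} → x ≤ y → 0# ≤ y - x
    x≤y⇒0≤y-x {x} {y} x≤y = begin
      0#     ≈⟨ K.-‿inverseʳ x ⟨
      x - x  ≤⟨ +-monoˡ-≤ (- x) x≤y ⟩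
      y - x  ∎

    x-y+y : ∀ x y → (x - y) + y ≈ x
    x-y+y x y = K.trans (K.+-assoc x (- y) y)
      (K.trans (K.+-congˡ (K.-‿inverseˡ y)) (K.+-identityʳ x))

    0≤y-x⇒x≤y : ∀ {x y} → 0# ≤ y - x → x ≤ y
    0≤y-x⇒x≤y {x} {y} p = begin
      x            ≈⟨ K.+-identityˡ x ⟨
      0# + x       ≤⟨ +-monoˡ-≤ x p ⟩
      (y - x) + x  ≈⟨ x-y+y y x ⟩
      y            ∎

    *-monoˡ : ∀ {x y z} → 0# ≤ z → x ≤ y → x * z ≤ y * z
    *-monoˡ {x} {y} {z} 0≤z x≤y = 0≤y-x⇒x≤y (begin
      0#               ≤⟨ *-nonNegative (x≤y⇒0≤y-x x≤y) 0≤z ⟩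
      (y - x) * z      ≈⟨ K.distribʳ z y (- x) ⟩
      y * z + - x * z  ≈⟨ K.+-congˡ (-‿distribˡ-* x z) ⟨
      y * z - x * z    ∎)

    x≤0⇒0≤-x : ∀ {x} → x ≤ 0# → 0# ≤ - x
    x≤0⇒0≤-x {x} x≤0 = T.≤-respʳ-≈ (K.+-identityˡ (- x)) (x≤y⇒0≤y-x x≤0)

    0≤x² : ∀ x → 0# ≤ x * x
    0≤x² x with T.total 0# x
    ... | inj₁ 0≤x = *-nonNegative 0≤x 0≤x
    ... | inj₂ x≤0 = begin
      0#           ≤⟨ *-nonNegative (x≤0⇒0≤-x x≤0) (x≤0⇒0≤-x x≤0) ⟩
      - x * - x    ≈⟨ -‿distribˡ-* x (- x) ⟨
      - (x * - x)  ≈⟨ K.-‿cong (-‿distribʳ-* x x) ⟨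
      - - (x * x)  ≈⟨ -‿involutive (x * x) ⟩
      x * x        ∎

    0≤1 : 0# ≤ 1#
    0≤1 = T.≤-respʳ-≈ (K.*-identityˡ 1#) (0≤x² 1#)

    x≤1+x² : ∀ x → x ≤ 1# + x * x
    x≤1+x² x with T.total x 1#
    ... | inj₁ x≤1 = begin
      x            ≤⟨ x≤1 ⟩
      1#           ≈⟨ K.+-identityʳ 1# ⟨
      1# + 0#      ≤⟨ +-monoʳ 1# (0≤x² x) ⟩
      1# + x * x   ∎
    ... | inj₂ 1≤x = begin
      x            ≈⟨ K.*-identityˡ x ⟨
      1# * x       ≤⟨ *-monoˡ (T.trans 0≤1 1≤x) 1≤x ⟩
      x * x        ≈⟨ K.+-identityˡ (x * x) ⟨
      0# + x * x   ≤⟨ +-monoˡ-≤ (x * x) 0≤1 ⟩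
      1# + x * x   ∎

    0≤fromℕ : ∀ n → 0# ≤ fromℕ n
    0≤fromℕ zero    = T.refl
    0≤fromℕ (suc n) = begin
      0#            ≤⟨ 0≤fromℕ n ⟩
      fromℕ n       ≈⟨ K.+-identityˡ (fromℕ n) ⟨
      0# + fromℕ n  ≤⟨ +-monoˡ-≤ (fromℕ n) 0≤1 ⟩
      1# + fromℕ n  ∎

    fromℕ-mono : ∀ {m n} → m ℕ.≤ n → fromℕ m ≤ fromℕ n
    fromℕ-mono {n = n} ℕ.z≤n = 0≤fromℕ n
    fromℕ-mono (ℕ.s≤s m≤n)   = +-monoʳ 1# (fromℕ-mono m≤n)

    1≤x⇒x≉0 : ∀ {x} → 1# ≤ x → ¬ x ≈ 0#
    1≤x⇒x≉0 1≤x x≈0 = 0≉1 (T.antisym 0≤1 (T.≤-respʳ-≈ x≈0 1≤x))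

    0≤x⁻¹ : ∀ {x} → 1# ≤ x → 0# ≤ x ⁻¹
    0≤x⁻¹ {x} 1≤x with T.total 0# (x ⁻¹)
    ... | inj₁ 0≤x⁻¹ = 0≤x⁻¹
    ... | inj₂ x⁻¹≤0 = contradiction (T.antisym 0≤1 (begin
      1#             ≈⟨ ⁻¹-inverseʳ x (1≤x⇒x≉0 1≤x) ⟨
      x * x ⁻¹       ≈⟨ K.*-comm x (x ⁻¹) ⟩
      x ⁻¹ * x       ≤⟨ *-monoˡ (T.trans 0≤1 1≤x) x⁻¹≤0 ⟩
      0# * x         ≈⟨ K.zeroˡ x ⟩
      0#             ∎)) 0≉1

    2x≤y⇒2y⁻¹≤x⁻¹ : ∀ {x y} → 1# ≤ x → 1# ≤ y → x + x ≤ y → y ⁻¹ + y ⁻¹ ≤ x ⁻¹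
    2x≤y⇒2y⁻¹≤x⁻¹ {x} {y} 1≤x 1≤y 2x≤y = begin
      y ⁻¹ + y ⁻¹                        ≈⟨ K.+-cong (cancel 1≤x) (cancel 1≤x) ⟨
      x * (x ⁻¹ * y ⁻¹) + x * (x ⁻¹ * y ⁻¹)
                                         ≈⟨ K.distribʳ (x ⁻¹ * y ⁻¹) x x ⟨
      (x + x) * (x ⁻¹ * y ⁻¹)            ≤⟨ *-monoˡ (*-nonNegative (0≤x⁻¹ 1≤x) (0≤x⁻¹ 1≤y)) 2x≤y ⟩
      y * (x ⁻¹ * y ⁻¹)                  ≈⟨ K.*-congˡ (K.*-comm (x ⁻¹) (y ⁻¹)) ⟩
      y * (y ⁻¹ * x ⁻¹)                  ≈⟨ cancel 1≤y ⟩
      x ⁻¹                               ∎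
      where
      cancel : ∀ {a b} → 1# ≤ a → a * (a ⁻¹ * b) ≈ b
      cancel {a} {b} 1≤a = K.trans (K.sym (K.*-assoc a (a ⁻¹) b))
        (K.trans (K.*-congʳ (⁻¹-inverseʳ a (1≤x⇒x≉0 1≤a))) (K.*-identityˡ b))

  -- √ s is the largest y with y² ≤ s; it has the junk value 0 for s < 0.

  private
    √-sup : ∀ s → ∃ (IsSup _≤_ (λ y → y * y ≤ s ⊔ 0#))
    √-sup s = complete (λ y → y * y ≤ s ⊔ 0#)
      (0# , T.≤-respˡ-≈ (K.sym (K.zeroˡ 0#)) (x≤y⊔x s 0#))
      (1# + (s ⊔ 0#) , λ y y²≤s → T.trans (x≤1+x² y) (+-monoʳ 1# y²≤s))
      where
      module K = CommutativeRing commutativeRing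
      module T = TotalOrder totalOrder
      open NaturalMax totalOrder using (x≤y⊔x)
      open OrderLemmas

  √ : ℝ → ℝ
  √ s = proj₁ (√-sup s)

  √-isSup : ∀ s → IsSup _≤_ (λ y → y * y ≤ s ⊔ 0#) (√ s)
  √-isSup s = proj₂ (√-sup s)

  -- Partial sums of e = ∑ 1/k!.

  eSum : ℕ → ℝ
  eSum zero    = 0#
  eSum (suc n) = eSum n + fromℕ (n !) ⁻¹

  module ESumLemmas where

    private
      module K = CommutativeRing commutativeRing
      module T = TotalOrder totalOrder
      module M = MonoidMult K.+-monoid
    open OrderLemmas
    open PartialOrderReasoning T.poset

    1≤fromℕ! : ∀ n → 1# ≤ fromℕ (n !)
    1≤fromℕ! n = T.≤-respˡ-≈ (M.×-homo-1 1#) (fromℕ-mono (ℕ.1≤n! n))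

    double! : ∀ n → suc n ! ℕ.+ suc n ! ℕ.≤ suc (suc n) !
    double! n = ℕ.+-monoʳ-≤ (suc n !) (ℕ.m≤m+n (suc n !) (n ℕ.* suc n !))

    eTerm-halves : ∀ n → fromℕ (suc (suc n) !) ⁻¹ + fromℕ (suc (suc n) !) ⁻¹ ≤ fromℕ (suc n !) ⁻¹
    eTerm-halves n = 2x≤y⇒2y⁻¹≤x⁻¹ (1≤fromℕ! (suc n)) (1≤fromℕ! (suc (suc n))) (begin
      fromℕ (suc n !) + fromℕ (suc n !)  ≈⟨ M.×-homo-+ 1# (suc n !) (suc n !) ⟨
      fromℕ (suc n ! ℕ.+ suc n !)        ≤⟨ fromℕ-mono (double! n) ⟩
      fromℕ (suc (suc n) !)              ∎)

    eBound : ℝ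
    eBound = eSum 2 + fromℕ (1 !) ⁻¹

    eSum-tail : ∀ n → eSum (suc (suc n)) + fromℕ (suc n !) ⁻¹ ≤ eBound
    eSum-tail zero    = T.refl
    eSum-tail (suc n) = begin
      (eSum (suc (suc n)) + t) + t  ≈⟨ K.+-assoc (eSum (suc (suc n))) t t ⟩
      eSum (suc (suc n)) + (t + t)  ≤⟨ +-monoʳ (eSum (suc (suc n))) (eTerm-halves n) ⟩
      eSum (suc (suc n)) + fromℕ (suc n !) ⁻¹  ≤⟨ eSum-tail n ⟩
      eBound                        ∎
      where t = fromℕ (suc (suc n) !) ⁻¹

    eSum-step : ∀ n → eSum n ≤ eSum (suc n)
    eSum-step n = begin
      eSum n                     ≈⟨ K.+-identityʳ (eSum n) ⟨
      eSum n + 0#                ≤⟨ +-monoʳ (eSum n) (0≤x⁻¹ (1≤fromℕ! n)) ⟩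
      eSum n + fromℕ (n !) ⁻¹    ∎

    eSum-bounded : ∀ n → eSum n ≤ eBound
    eSum-bounded n = begin
      eSum n                                   ≤⟨ eSum-step n ⟩
      eSum (suc n)                             ≤⟨ eSum-step (suc n) ⟩
      eSum (suc (suc n))                       ≈⟨ K.+-identityʳ _ ⟨
      eSum (suc (suc n)) + 0#                  ≤⟨ +-monoʳ _ (0≤x⁻¹ (1≤fromℕ! (suc n))) ⟩
      eSum (suc (suc n)) + fromℕ (suc n !) ⁻¹  ≤⟨ eSum-tail n ⟩
      eBound                                   ∎

  private
    e-sup : ∃ (IsSup _≤_ (λ s → ∃ λ n → s ≈ eSum n))
    e-sup = complete (λ s → ∃ λ n → s ≈ eSum n)
      (0# , 0 , K.refl)
      (eBound , λ { s (n , s≈) → T.≤-respˡ-≈ (K.sym s≈) (eSum-bounded n) })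
      where
      module K = CommutativeRing commutativeRing
      module T = TotalOrder totalOrder
      open ESumLemmas

  e : ℝ
  e = proj₁ e-sup

  e-isSup : IsSup _≤_ (λ s → ∃ λ n → s ≈ eSum n) e
  e-isSup = proj₂ e-sup

  ----------------------------------------------------------------------
  -- Euclidean space
  ----------------------------------------------------------------------

  ℝ^_ : ℕ → Set
  ℝ^ d = Vector ℝ d

  infixl 6 _-ᵛ_

  _-ᵛ_ : ∀ {d} → ℝ^ d → ℝ^ d → ℝ^ d
  _-ᵛ_ = zipWith _-_

  0ᵛ : ∀ {d} → ℝ^ d
  0ᵛ {d} = replicate d 0#

  ⟨_,_⟩ : ∀ {d} → ℝ^ d → ℝ^ d → ℝ
  ⟨ x , y ⟩ = sum (zipWith _*_ x y)

  ‖_‖ : ∀ {d} → ℝ^ d → ℝ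
  ‖ x ‖ = √ ⟨ x , x ⟩

  B : ∀ {d} → ℝ^ d → ℝ → Pred (ℝ^ d) 0ℓ
  B c r x = ‖ x -ᵛ c ‖ ≤ r

  Matrix : ℕ → ℕ → Set
  Matrix m n = Vector (ℝ^ n) m

  _*ᵛ_ : ∀ {m n} → Matrix m n → ℝ^ n → ℝ^ m
  (H *ᵛ v) i = ⟨ H i , v ⟩

  ----------------------------------------------------------------------
  -- Lipschitz and differentiable functions
  ----------------------------------------------------------------------

  module _ {d : ℕ} where

    Range : (ℝ^ d → ℝ) → Pred ℝ 0ℓ
    Range f y = ∃ λ x → y ≈ f x

    Lipschitz : ℝ → (ℝ^ d → ℝ) → Set
    Lipschitz L f = ∀ x y → ∣ f x - f y ∣ ≤ L * ‖ x -ᵛ y ‖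

    Lipschitzᵛ : ∀ {m} → ℝ → (ℝ^ d → ℝ^ m) → Set
    Lipschitzᵛ L F = ∀ x y → ‖ F x -ᵛ F y ‖ ≤ L * ‖ x -ᵛ y ‖

    IsGlobalMinimizer : (ℝ^ d → ℝ) → Pred (ℝ^ d) 0ℓ
    IsGlobalMinimizer f x = ∀ y → f x ≤ f y

    -- Fréchet derivatives.  The case y ≈ x is not excluded, so that
    -- differentiable functions automatically respect equality.

    IsGradient : (ℝ^ d → ℝ) → (ℝ^ d → ℝ^ d) → Set
    IsGradient f g = ∀ x ε → 0# < ε → ∃ λ δ → 0# < δ ∧
      (∀ y → ‖ y -ᵛ x ‖ < δ →
        ∣ (f y - f x) - ⟨ g x , y -ᵛ x ⟩ ∣ ≤ ε * ‖ y -ᵛ x ‖)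

    IsJacobian : ∀ {m} → (ℝ^ d → ℝ^ m) → (ℝ^ d → Matrix m d) → Set
    IsJacobian F J = ∀ x ε → 0# < ε → ∃ λ δ → 0# < δ ∧
      (∀ y → ‖ y -ᵛ x ‖ < δ →
        ‖ (F y -ᵛ F x) -ᵛ (J x *ᵛ (y -ᵛ x)) ‖ ≤ ε * ‖ y -ᵛ x ‖)

  record TwiceDifferentiable (d : ℕ) : Set where
    field
      f          : ℝ^ d → ℝ
      ∇f         : ℝ^ d → ℝ^ d
      ∇²f        : ℝ^ d → Matrix d d
      isGradient : IsGradient f ∇f
      isHessian  : IsJacobian ∇f ∇²f

  ----------------------------------------------------------------------
  -- Algorithms with oracle access up to second order
  ----------------------------------------------------------------------

  module _ (d : ℕ) where

    pointSetoid matrixSetoid answerSetoid historySetoid actionSetoid : Setoid 0ℓ 0ℓ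
    pointSetoid   = VectorEquality.≋-setoid setoid d
    matrixSetoid  = VectorEquality.≋-setoid pointSetoid d
    answerSetoid  = setoid ×ₛ (pointSetoid ×ₛ matrixSetoid)
    historySetoid = ListPointwise.setoid answerSetoid
    actionSetoid  = pointSetoid ⊎ₛ pointSetoid

    -- The next action is a function of the answers received so far, most
    -- recent first: inj₁ q queries the oracle at q, inj₂ x stops with output x.
    -- The query points need not be recorded, as they are determined by the
    -- earlier answers.

    Algorithm : Set
    Algorithm = Func historySetoid actionSetoid

    Answer : Set
    Answer = Setoid.Carrier answerSetoid

  module _ {d : ℕ} (A : Algorithm d) (g : TwiceDifferentiable d) where

    open TwiceDifferentiable g

    oracle : ℝ^ d → Answer d
    oracle q = f q , ∇f q , ∇²f q

    -- RunsFrom h x n: having received the answers h, the algorithm makes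
    -- exactly n further oracle calls and then outputs x.

    data RunsFrom (h : List (Answer d)) (x : ℝ^ d) : ℕ → Set where
      stop : Func.to A h ≡ inj₂ x → RunsFrom h x 0
      call : ∀ {q n} → Func.to A h ≡ inj₁ q →
             RunsFrom (oracle q ∷ h) x n → RunsFrom h x (suc n)

    OutputsAfter : ℕ → ℝ^ d → Set
    OutputsAfter n x = RunsFrom [] x n

module Submission where

open import Algebra.Bundles using (CommutativeRing)
open import Algebra.Solver.Ring.AlmostCommutativeRing
  using (_-Raw-AlmostCommutative⟶_; fromCommutativeRing; Induced-equivalence)
open import Axiom.ExcludedMiddle using (ExcludedMiddle)
open import Data.Bool.Base using (if_then_else_)
open import Data.Fin.Base using (Fin; zero; suc; toℕ; fromℕ<)
open import Data.Fin.Properties using (_≟_; toℕ-injective; toℕ≤pred[n]; toℕ-fromℕ<)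
open import Data.Integer.Base as ℤ using (ℤ; +_; -[1+_]; +[1+_]; _⊖_)
import Data.Integer.Properties as ℤ
open import Data.List.Base as List using ([]; _∷_)
open import Data.List.Relation.Binary.Pointwise using (Pointwise; []; _∷_)
open import Data.Maybe.Base using (just; nothing)
open import Data.Nat.Base as ℕ using (ℕ; zero; suc; z≤n; s≤s; _≥_; _^_; NonZero; >-nonZero)
import Data.Nat.Properties as ℕ
open import Data.Product.Base using (Σ; ∃; ∃₂; _,_; proj₁; proj₂) renaming (_×_ to _∧_)
open import Data.Sum.Base using (_⊎_; inj₁; inj₂; [_,_]′)
open import Data.Sum.Relation.Binary.Pointwise using (inj₁; inj₂)
open import Data.Vec.Functional as Vector using (Vector; head; tail)
open import Function.Base using (id; _∘_)
open import Function.Bundles using (Func)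
open import Level using (0ℓ)
open import Relation.Binary.Bundles using (Setoid; TotalOrder)
open import Relation.Binary.Definitions using (WeaklyDecidable; tri<; tri≈; tri>)
open import Relation.Binary.PropositionalEquality.Core as ≡ using (_≡_; _≢_)
open import Relation.Nullary.Decidable using (does; yes; no)
open import Relation.Nullary.Negation using (¬_; contradiction)
open import Relation.Unary using (_∈_)
import Algebra.Construct.NaturalChoice.Max as NaturalMax
import Algebra.Properties.AbelianGroup as AbelianGroupProperties
import Algebra.Properties.Ring as RingProperties
import Algebra.Properties.Semiring.Mult.TCOptimised as Multiples
import Algebra.Properties.Semiring.Sum as SemiringSum
import Algebra.Solver.Ring
import Relation.Binary.Reasoning.Setoid as SetoidReasoning
open import Defs

-- The resisting oracle answers every query with zeros, so that the first 2^d
-- points visited do not depend on the function.  The function is the bump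
-- -⅓ max(0, 1 - ‖x - c‖²)³, which is invisible outside the unit ball about c;
-- its depth ⅓ lies in (1/(2e), 1/e] because 2 ≤ e ≤ 3.  It remains to place c
-- in B(0,10) at distance at least 1 from all 2^d points.
--
-- Candidates for c are the grid points a w, w ∈ {-2,…,2}^d, with a² d = 25, so
-- that ‖a w‖² ≤ 4 a² d = 100.  Two of them within distance 1 of a common point
-- differ in at most 4d/25 coordinates.  So pick for each visited point one
-- candidate s near it; a word w agreeing with every s in fewer than 4d/5
-- coordinates will do.  Averaging the weight ∑ₛ 32^(agreements of w and s) over
-- all w gives (36/5)^d per word s, and choosing the letters of w one at a time
-- keeps the weight below this mean.

-- Integer coefficients for the ring solver

module IntegerCoefficients {c ℓ} (K : CommutativeRing c ℓ) where

  open CommutativeRing K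
  open RingProperties ring using (-‿distribˡ-*; -‿distribʳ-*; -‿involutive; -0#≈0#)
  open AbelianGroupProperties +-abelianGroup using (⁻¹-∙-comm)
  open Multiples semiring
  open SetoidReasoning setoid

  -- The multiples `×` are the type-checking-optimised ones, for which `1 × 1#` reduces to `1#`;
  -- thus constants in solver terms agree with those in the goals.
  fromℤ : ℤ → Carrier
  fromℤ (+ n)    = n × 1#
  fromℤ -[1+ n ] = - (suc n × 1#)

  fromℤ-⊖ : ∀ m n → fromℤ (m ⊖ n) ≈ m × 1# - n × 1#
  fromℤ-⊖ zero    zero    = sym (-‿inverseʳ 0#)
  fromℤ-⊖ zero    (suc n) = sym (+-identityˡ _)
  fromℤ-⊖ (suc m) zero    = sym (trans (+-congˡ -0#≈0#) (+-identityʳ _))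
  fromℤ-⊖ (suc m) (suc n) = begin
    fromℤ (suc m ⊖ suc n)              ≡⟨ ≡.cong fromℤ (ℤ.[1+m]⊖[1+n]≡m⊖n m n) ⟩
    fromℤ (m ⊖ n)                      ≈⟨ fromℤ-⊖ m n ⟩
    a - b                              ≈⟨ +-congʳ (+-identityˡ a) ⟨
    (0# + a) - b                       ≈⟨ +-congʳ (+-congʳ (-‿inverseʳ 1#)) ⟨
    ((1# - 1#) + a) - b                ≈⟨ +-congʳ (trans (+-assoc _ _ _) (trans (+-congˡ (+-comm _ _)) (sym (+-assoc _ _ _)))) ⟩
    ((1# + a) - 1#) - b                ≈⟨ +-assoc _ _ _ ⟩
    (1# + a) + (- 1# - b)              ≈⟨ +-congˡ (⁻¹-∙-comm 1# b) ⟩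
    (1# + a) - (1# + b)                ≈⟨ +-cong (1+× m 1#) (-‿cong (1+× n 1#)) ⟨
    suc m × 1# - suc n × 1#            ∎
    where
    a = m × 1#
    b = n × 1#

  fromℤ-+ : ∀ i j → fromℤ (i ℤ.+ j) ≈ fromℤ i + fromℤ j
  fromℤ-+ (+ m)    (+ n)    = ×-homo-+ 1# m n
  fromℤ-+ (+ m)    -[1+ n ] = fromℤ-⊖ m (suc n)
  fromℤ-+ -[1+ m ] (+ n)    = trans (fromℤ-⊖ n (suc m)) (+-comm _ _)
  fromℤ-+ -[1+ m ] -[1+ n ] = begin
    - (suc (suc (m ℕ.+ n)) × 1#)       ≡⟨ ≡.cong (λ k → - (suc k × 1#)) (ℕ.+-suc m n) ⟨
    - ((suc m ℕ.+ suc n) × 1#)         ≈⟨ -‿cong (×-homo-+ 1# (suc m) (suc n)) ⟩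
    - (suc m × 1# + suc n × 1#)        ≈⟨ ⁻¹-∙-comm _ _ ⟨
    - (suc m × 1#) - suc n × 1#        ∎

  fromℤ-neg : ∀ i → fromℤ (ℤ.- i) ≈ - fromℤ i
  fromℤ-neg (+ zero)  = sym -0#≈0#
  fromℤ-neg +[1+ n ]  = refl
  fromℤ-neg -[1+ n ]  = sym (-‿involutive _)

  fromℤ-pos* : ∀ m j → fromℤ (+ m ℤ.* j) ≈ m × 1# * fromℤ j
  fromℤ-pos* m (+ n) = begin
    fromℤ (+ m ℤ.* + n)                ≡⟨ ≡.cong fromℤ (ℤ.pos-* m n) ⟨
    (m ℕ.* n) × 1#                     ≈⟨ ×1-homo-* m n ⟩
    m × 1# * (n × 1#)                  ∎
  fromℤ-pos* m -[1+ n ] = begin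
    fromℤ (+ m ℤ.* ℤ.- + suc n)        ≡⟨ ≡.cong fromℤ (ℤ.neg-distribʳ-* (+ m) (+ suc n)) ⟨
    fromℤ (ℤ.- (+ m ℤ.* + suc n))      ≈⟨ fromℤ-neg (+ m ℤ.* + suc n) ⟩
    - fromℤ (+ m ℤ.* + suc n)          ≈⟨ -‿cong (fromℤ-pos* m (+ suc n)) ⟩
    - (m × 1# * (suc n × 1#))          ≈⟨ -‿distribʳ-* _ _ ⟩
    m × 1# * - (suc n × 1#)            ∎

  fromℤ-* : ∀ i j → fromℤ (i ℤ.* j) ≈ fromℤ i * fromℤ j
  fromℤ-* (+ m)    j = fromℤ-pos* m j
  fromℤ-* -[1+ m ] j = begin
    fromℤ (ℤ.- + suc m ℤ.* j)          ≡⟨ ≡.cong fromℤ (ℤ.neg-distribˡ-* (+ suc m) j) ⟨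
    fromℤ (ℤ.- (+ suc m ℤ.* j))        ≈⟨ fromℤ-neg (+ suc m ℤ.* j) ⟩
    - fromℤ (+ suc m ℤ.* j)            ≈⟨ -‿cong (fromℤ-pos* (suc m) j) ⟩
    - (suc m × 1# * fromℤ j)           ≈⟨ -‿distribˡ-* _ _ ⟩
    - (suc m × 1#) * fromℤ j           ∎

  homomorphism : ℤ.+-*-rawRing -Raw-AlmostCommutative⟶ fromCommutativeRing K
  homomorphism = record
    { ⟦_⟧    = fromℤ
    ; +-homo = fromℤ-+
    ; *-homo = fromℤ-*
    ; -‿homo = fromℤ-neg
    ; 0-homo = refl
    ; 1-homo = refl
    }

  -- Distinct integers may have equal images in a ring of positive characteristic, so a negative
  -- answer in ℤ yields `nothing`.
  coefficient-≟ : WeaklyDecidable (Induced-equivalence homomorphism)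
  coefficient-≟ i j with i ℤ.≟ j
  ... | yes i≡j = just (reflexive (≡.cong fromℤ i≡j))
  ... | no  _   = nothing

  open Algebra.Solver.Ring ℤ.+-*-rawRing (fromCommutativeRing K) homomorphism coefficient-≟ public
    using (solve; con; _:=_; _:+_; _:*_; _:-_; :-_)

-- Complete ordered fields: inequalities, bounds on e, square roots

module OrderedField (em : ExcludedMiddle 0ℓ) (R : CompleteOrderedField) where

  open Reals R public
  open CommutativeRing commutativeRing public
    using (refl; sym; trans; +-cong; +-congˡ; +-congʳ; *-cong; *-congˡ; *-congʳ; -‿cong;
      *-comm; *-assoc; +-identityˡ; +-identityʳ; *-identityˡ; *-identityʳ; zeroˡ; zeroʳ; -‿inverseʳ)
  open TotalOrder totalOrder public
    using (antisym; total; ≤-respˡ-≈; ≤-respʳ-≈)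
    renaming (refl to ≤-refl; trans to ≤-trans; reflexive to ≤-reflexive)
  open OrderLemmas public
  open IntegerCoefficients commutativeRing public
  open NaturalMax totalOrder public using (x≤x⊔y; x≤y⊔x; ⊔-lub; ⊔-sel)

  -- # n is definitionally the solver's value of con (+ n), unlike fromℕ n.

  infix 9 #_

  #_ : ℕ → ℝ
  # n = fromℤ (+ n)

  fromℕ≈# : ∀ n → fromℕ n ≈ # n
  fromℕ≈# n = ×ᵤ≈× n 1#
    where open Multiples (CommutativeRing.semiring commutativeRing) using (×ᵤ≈×)

  0≤# : ∀ n → 0# ≤ # n
  0≤# n = ≤-respʳ-≈ (fromℕ≈# n) (0≤fromℕ n)

  #-mono : ∀ {m n} → m ℕ.≤ n → # m ≤ # n
  #-mono {m} {n} m≤n = ≤-respˡ-≈ (fromℕ≈# m) (≤-respʳ-≈ (fromℕ≈# n) (fromℕ-mono m≤n))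

  1≰0 : ¬ 1# ≤ 0#
  1≰0 1≤0 = 0≉1 (antisym 0≤1 1≤0)

  infixr 6 _⊕_
  infixr 7 _⊛_

  _⊕_ : ∀ {x y} → 0# ≤ x → 0# ≤ y → 0# ≤ x + y
  _⊕_ {x} {y} 0≤x 0≤y = ≤-trans 0≤y (≤-respˡ-≈ (+-identityˡ y) (+-monoˡ-≤ y 0≤x))

  _⊛_ : ∀ {x y} → 0# ≤ x → 0# ≤ y → 0# ≤ x * y
  _⊛_ = *-nonNegative

  -- The pattern for most inequalities below: a term `p`, nonnegative by an argument assembled from
  -- `_⊕_` and `_⊛_`, and a polynomial identity left to the solver. The bracketing of the
  -- polynomials follows the right associativity of these operators.
  ≤-by : ∀ {x y p} → 0# ≤ p → y - x ≈ p → x ≤ y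
  ≤-by 0≤p y-x≈p = 0≤y-x⇒x≤y (≤-respʳ-≈ (sym y-x≈p) 0≤p)

  gap : ∀ {x y} → x ≤ y → 0# ≤ y - x
  gap = x≤y⇒0≤y-x

  #-cancel-≤ : ∀ {m n} → # m ≤ # n → m ℕ.≤ n
  #-cancel-≤ {m} {n} #m≤#n with m ℕ.≤? n
  ... | yes m≤n = m≤n
  ... | no  m≰n = contradiction
    (≤-by (gap #m≤#n ⊕ gap (≤-respˡ-≈ (fromℤ-+ (+ 1) (+ n)) (#-mono (ℕ.≰⇒> m≰n))))
      (solve 2 (λ m n → con (+ 0) :- con (+ 1) := (n :- m) :+ (m :- (con (+ 1) :+ n))) refl (# m) (# n)))
    1≰0

  -- If `x` were invertible, multiplying by the square of `x ⁻¹` would give `1# ≤ 0#`.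
  x²≤0⇒x≈0 : ∀ {x} → x * x ≤ 0# → x ≈ 0#
  x²≤0⇒x≈0 {x} x²≤0 with em {P = x ≈ 0#}
  ... | yes x≈0 = x≈0
  ... | no  x≉0 = contradiction
    (≤-by (gap x²≤0 ⊛ 0≤x² (x ⁻¹))
      (trans (+-congˡ (-‿cong (trans (sym (*-identityˡ 1#)) (*-cong (sym xx⁻¹≈1) (sym xx⁻¹≈1)))))
        (solve 2 (λ x y → con (+ 0) :- (x :* y) :* (x :* y) := (con (+ 0) :- x :* x) :* (y :* y)) refl x (x ⁻¹))))
    1≰0
    where
    xx⁻¹≈1 = ⁻¹-inverseʳ x x≉0

  -- If `y ≤ x`, then `(x - y)² = (x² - y²) - 2y(x - y)` is at most 0, so `x` and `y` agree.
  x²≤y²⇒x≤y : ∀ {x y} → 0# ≤ y → x * x ≤ y * y → x ≤ y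
  x²≤y²⇒x≤y {x} {y} 0≤y x²≤y² with total x y
  ... | inj₁ x≤y = x≤y
  ... | inj₂ y≤x = ≤-by ≤-refl (trans
    (solve 2 (λ x y → y :- x := :- (x :- y)) refl x y)
    (trans (-‿cong (x²≤0⇒x≈0 (≤-by (gap x²≤y² ⊕ (0≤# 2 ⊛ 0≤y ⊛ gap y≤x))
      (solve 2 (λ x y → con (+ 0) :- (x :- y) :* (x :- y) :=
        (y :* y :- x :* x) :+ con (+ 2) :* (y :* (x :- y))) refl x y))))
      (solve 0 (:- con (+ 0) := con (+ 0)) refl)))

  x⁻¹≤y⁻¹⇒y≤x : ∀ {x y} → 1# ≤ x → 1# ≤ y → x ⁻¹ ≤ y ⁻¹ → y ≤ x
  x⁻¹≤y⁻¹⇒y≤x {x} {y} 1≤x 1≤y x⁻¹≤y⁻¹ = ≤-by ((≤-trans 0≤1 1≤x ⊛ ≤-trans 0≤1 1≤y) ⊛ gap x⁻¹≤y⁻¹)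
    (trans (+-cong (sym (trans (*-congˡ (⁻¹-inverseʳ y (1≤x⇒x≉0 1≤y))) (*-identityʳ x)))
                   (-‿cong (sym (trans (*-congˡ (⁻¹-inverseʳ x (1≤x⇒x≉0 1≤x))) (*-identityʳ y)))))
      (solve 4 (λ x y u v → x :* (y :* v) :- y :* (x :* u) := (x :* y) :* (v :- u)) refl x y (x ⁻¹) (y ⁻¹)))

  y≤x⇒x⁻¹≤y⁻¹ : ∀ {x y} → 1# ≤ y → y ≤ x → x ⁻¹ ≤ y ⁻¹
  y≤x⇒x⁻¹≤y⁻¹ {x} {y} 1≤y y≤x = ≤-by ((0≤x⁻¹ 1≤x ⊛ 0≤x⁻¹ 1≤y) ⊛ gap y≤x)
    (trans (+-cong (sym (trans (*-congˡ (⁻¹-inverseʳ x (1≤x⇒x≉0 1≤x))) (*-identityʳ (y ⁻¹))))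
                   (-‿cong (sym (trans (*-congˡ (⁻¹-inverseʳ y (1≤x⇒x≉0 1≤y))) (*-identityʳ (x ⁻¹))))))
      (solve 4 (λ x y u v → v :* (x :* u) :- u :* (y :* v) := (u :* v) :* (x :- y)) refl x y (x ⁻¹) (y ⁻¹)))
    where
    1≤x = ≤-trans 1≤y y≤x

  x⁻¹≈1 : ∀ {x} → x ≈ 1# → x ⁻¹ ≈ 1#
  x⁻¹≈1 {x} x≈1 = trans (sym (*-identityˡ (x ⁻¹))) (trans (*-congʳ (sym x≈1))
    (⁻¹-inverseʳ x (1≤x⇒x≉0 (≤-reflexive (sym x≈1)))))

  2≤e : # 2 ≤ e
  2≤e = ≤-respˡ-≈ (trans (+-cong (trans (+-identityˡ _) one) one) refl) (proj₁ e-isSup (eSum 2) (2 , refl))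
    where
    one = x⁻¹≈1 (+-identityʳ 1#)

  -- `eBound` is `1 + 1 + 1`. It dominates every partial sum because from `1/1!` on each term is at
  -- most half of the preceding one.
  e≤3 : e ≤ # 3
  e≤3 = ≤-respʳ-≈ (+-cong (trans (+-cong (trans (+-identityˡ _) one) one) refl) one)
    (proj₂ e-isSup eBound λ { x (n , x≈) → ≤-respˡ-≈ (sym x≈) (eSum-bounded n) })
    where
    open ESumLemmas
    one = x⁻¹≈1 (+-identityʳ 1#)

  √-nonNegative : ∀ s → 0# ≤ √ s
  √-nonNegative s = proj₁ (√-isSup s) 0# (≤-respˡ-≈ (sym (zeroˡ 0#)) (x≤y⊔x s 0#))

  -- If `y² ≤ s`, a slightly larger `y + h` still has square at most `s`; if `s ≤ y²`, a slightly
  -- smaller `y - h` is still an upper bound. Either way the supremum property forces `h ≤ 0`, and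
  -- `h` is the defect `D` divided by some `T ≥ 1`.
  √s*√s≈s : ∀ {s} → 0# ≤ s → √ s * √ s ≈ s
  √s*√s≈s {s} 0≤s = antisym y²≤s s≤y²
    where
    y = √ s
    0≤y = √-nonNegative s

    s⊔0≈s : s ⊔ 0# ≈ s
    s⊔0≈s = antisym (⊔-lub ≤-refl 0≤s) (x≤x⊔y s 0#)

    upper : ∀ z → z * z ≤ s → z ≤ y
    upper z z²≤s = proj₁ (√-isSup s) z (≤-respʳ-≈ (sym s⊔0≈s) z²≤s)

    least : ∀ b → (∀ z → z * z ≤ s → z ≤ b) → y ≤ b
    least b ub = proj₂ (√-isSup s) b λ z z²≤ → ub z (≤-respʳ-≈ s⊔0≈s z²≤)

    s≤y² : s ≤ y * y
    s≤y² with total s (y * y)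
    ... | inj₁ s≤y² = s≤y²
    ... | inj₂ y²≤s = ≤-by (gap y+h≤y ⊛ ≤-trans 0≤1 1≤T)
      (trans (solve 2 (λ s y → y :* y :- s := :- (s :- y :* y)) refl s y)
        (trans (-‿cong (sym hT≈D))
          (solve 3 (λ y h T → :- (h :* T) := (y :- (y :+ h)) :* T) refl y h T)))
      where
      D = s - y * y
      -- As `T ≥ 1`, the quotient `h = D/T` is at most `D`, so `h(2y + h) ≤ hT = D` and
      -- `(y + h)² ≤ s`.
      T = # 2 * y + 1# + D
      0≤D = gap y²≤s
      1≤T : 1# ≤ T
      1≤T = ≤-by ((0≤# 2 ⊛ 0≤y) ⊕ 0≤D)
        (solve 2 (λ y D → con (+ 2) :* y :+ con (+ 1) :+ D :- con (+ 1) := con (+ 2) :* y :+ D) refl y D)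
      h = D * T ⁻¹
      0≤h = 0≤D ⊛ 0≤x⁻¹ 1≤T
      hT≈D : h * T ≈ D
      hT≈D = trans (*-assoc D (T ⁻¹) T) (trans (*-congˡ (trans (*-comm _ _) (⁻¹-inverseʳ T (1≤x⇒x≉0 1≤T)))) (*-identityʳ D))
      h≤D : h ≤ D
      h≤D = ≤-by (0≤h ⊛ gap 1≤T) (trans (+-congʳ (sym hT≈D))
        (solve 2 (λ h T → h :* T :- h := h :* (T :- con (+ 1))) refl h T))
      y+h≤y : y + h ≤ y
      y+h≤y = upper (y + h) (≤-by (0≤h ⊛ (0≤1 ⊕ gap h≤D))
        (trans (solve 3 (λ s y h → s :- (y :+ h) :* (y :+ h) := (s :- y :* y) :- con (+ 2) :* y :* h :- h :* h) refl s y h)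
          (trans (+-congʳ (+-congʳ (sym hT≈D)))
          (solve 3 (λ y h D → h :* (con (+ 2) :* y :+ con (+ 1) :+ D) :- con (+ 2) :* y :* h :- h :* h
            := h :* (con (+ 1) :+ (D :- h))) refl y h D))))

    y²≤s : y * y ≤ s
    y²≤s with total (y * y) s
    ... | inj₁ y²≤s = y²≤s
    ... | inj₂ s≤y² = ≤-by (gap y≤y-h ⊛ ≤-trans 0≤1 1≤T)
      (trans (solve 2 (λ s y → s :- y :* y := :- (y :* y :- s)) refl s y)
        (trans (-‿cong (sym hT≈D))
          (solve 3 (λ y h T → :- (h :* T) := (y :- h :- y) :* T) refl y h T)))
      where
      D = y * y - s
      -- Now `D = hT = 2yh + h`, whence `(y - h)² - s = h + h²`.
      T = # 2 * y + 1#
      0≤D = gap s≤y²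
      1≤T : 1# ≤ T
      1≤T = ≤-by (0≤# 2 ⊛ 0≤y)
        (solve 1 (λ y → con (+ 2) :* y :+ con (+ 1) :- con (+ 1) := con (+ 2) :* y) refl y)
      h = D * T ⁻¹
      0≤T⁻¹ = 0≤x⁻¹ 1≤T
      0≤h = 0≤D ⊛ 0≤T⁻¹
      TT⁻¹≈1 = ⁻¹-inverseʳ T (1≤x⇒x≉0 1≤T)
      hT≈D : h * T ≈ D
      hT≈D = trans (*-assoc D (T ⁻¹) T) (trans (*-congˡ (trans (*-comm _ _) TT⁻¹≈1)) (*-identityʳ D))
      -- Comparing squares needs `y - h` nonnegative: it equals `(y² + y + s)/T`.
      0≤y-h : 0# ≤ y - h
      0≤y-h = ≤-respʳ-≈
        (trans (solve 3 (λ s y u → (y :* y :+ y :+ s) :* u :=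
            y :* ((con (+ 2) :* y :+ con (+ 1)) :* u) :- (y :* y :- s) :* u) refl s y (T ⁻¹))
          (+-congʳ (trans (*-congˡ TT⁻¹≈1) (*-identityʳ y))))
        ((((0≤y ⊛ 0≤y) ⊕ 0≤y) ⊕ 0≤s) ⊛ 0≤T⁻¹)
      y≤y-h : y ≤ y - h
      y≤y-h = least (y - h) λ z z²≤s → x²≤y²⇒x≤y 0≤y-h (≤-trans z²≤s (≤-by (0≤h ⊕ 0≤h ⊛ 0≤h)
        (trans (solve 3 (λ s y h → (y :- h) :* (y :- h) :- s := (y :* y :- s) :- con (+ 2) :* y :* h :+ h :* h) refl s y h)
          (trans (+-congʳ (+-congʳ (sym hT≈D)))
          (solve 2 (λ y h → h :* (con (+ 2) :* y :+ con (+ 1)) :- con (+ 2) :* y :* h :+ h :* h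
            := h :+ h :* h) refl y h)))))

  -- Turns a quadratic remainder estimate, available only for displacements `t ≤ 1`, into the ε-δ
  -- form of differentiability. The choice `δ = ε/(K + ε)` is at most 1 and at most `ε/K`.
  quadratic⇒small : ∀ {K ε} → 1# ≤ K → 0# < ε → ∃ λ δ → 0# < δ ∧
    (∀ t → 0# ≤ t → t < δ → t ≤ 1# ∧ K * (t * t) ≤ ε * t)
  quadratic⇒small {K} {ε} 1≤K (0≤ε , 0≉ε) = δ , (0≤δ , 0≉δ) , bounds
    where
    T = K + ε
    1≤T : 1# ≤ T
    1≤T = ≤-by (gap 1≤K ⊕ 0≤ε) (solve 2 (λ K ε → K :+ ε :- con (+ 1) := (K :- con (+ 1)) :+ ε) refl K ε)
    δ = ε * T ⁻¹
    δT≈ε : δ * T ≈ ε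
    δT≈ε = trans (*-assoc ε (T ⁻¹) T) (trans (*-congˡ (trans (*-comm _ _) (⁻¹-inverseʳ T (1≤x⇒x≉0 1≤T)))) (*-identityʳ ε))
    0≤δ = 0≤ε ⊛ 0≤x⁻¹ 1≤T
    0≉δ : ¬ 0# ≈ δ
    0≉δ 0≈δ = 0≉ε (trans (sym (zeroˡ T)) (trans (*-congʳ 0≈δ) δT≈ε))
    0≤K = ≤-trans 0≤1 1≤K
    δ≤1 : δ ≤ 1#
    δ≤1 = ≤-by (0≤K ⊛ 0≤x⁻¹ 1≤T)
      (trans (+-congʳ (sym (⁻¹-inverseʳ T (1≤x⇒x≉0 1≤T))))
        (solve 3 (λ K ε u → (K :+ ε) :* u :- ε :* u := K :* u) refl K ε (T ⁻¹)))
    bounds : ∀ t → 0# ≤ t → t < δ → t ≤ 1# ∧ K * (t * t) ≤ ε * t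
    bounds t 0≤t (t≤δ , _) = ≤-trans t≤δ δ≤1 , ≤-by ((0≤K ⊛ gap t≤δ) ⊛ 0≤t ⊕ (0≤δ ⊛ 0≤ε) ⊛ 0≤t)
      (trans (+-congʳ (*-congʳ (sym δT≈ε)))
        (solve 4 (λ K ε δ t → δ :* (K :+ ε) :* t :- K :* (t :* t) := K :* (δ :- t) :* t :+ δ :* ε :* t)
          refl K ε δ t))

-- Words over a finite alphabet and an averaging argument

module Words where

  open import Data.Nat.Base using (_+_; _*_; _≤_; _<_)
  open import Data.Nat.Properties hiding (_≟_)
  open import Relation.Binary.PropositionalEquality using (refl; sym; trans; cong)
  open import Algebra.Properties.CommutativeSemigroup *-commutativeSemigroup using (x∙yz≈y∙xz)
  open SemiringSum +-*-semiring using (sum; sum-cong-≗; ∑-comm; *-distribˡ-sum)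

  ^-distribʳ-* : ∀ m n o → (m * n) ^ o ≡ m ^ o * n ^ o
  ^-distribʳ-* m n zero    = refl
  ^-distribʳ-* m n (suc o) = trans (cong (m * n *_) (^-distribʳ-* m n o)) ([m*n]*[o*p]≡[m*o]*[n*p] m n (m ^ o) (n ^ o))

  minimum : ∀ {m} (F : Vector ℕ (suc m)) → ∃ λ l → ∀ k → F l ≤ F k
  minimum {zero}  F = zero , λ { zero → ≤-refl }
  minimum {suc m} F with minimum (tail F)
  ... | l , F[l]≤ with ≤-total (head F) (F (suc l))
  ...   | inj₁ F₀≤ = zero , λ { zero → ≤-refl ; (suc k) → ≤-trans F₀≤ (F[l]≤ k) }
  ...   | inj₂ ≤F₀ = suc l , λ { zero → ≤F₀ ; (suc k) → F[l]≤ k }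

  *≤sum : ∀ {n c} (F : Vector ℕ n) → (∀ k → c ≤ F k) → n * c ≤ sum F
  *≤sum {zero}  F c≤F = z≤n
  *≤sum {suc n} F c≤F = +-mono-≤ (c≤F zero) (*≤sum (tail F) (c≤F ∘ suc))

  term≤sum : ∀ {n} (F : Vector ℕ n) i → F i ≤ sum F
  term≤sum F zero    = m≤m+n _ _
  term≤sum F (suc i) = ≤-trans (term≤sum (tail F) i) (m≤n+m _ _)

  ∃-≤mean : ∀ {m} (F : Vector ℕ (suc m)) → ∃ λ l → suc m * F l ≤ sum F
  ∃-≤mean F with minimum F
  ... | l , F[l]≤ = l , *≤sum F F[l]≤

  module Alphabet (q : ℕ) where

    Letter : Set
    Letter = Fin (suc q)

    Word : ℕ → Set
    Word d = Vector Letter d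

    match : Letter → Letter → ℕ
    match a b = if does (a ≟ b) then 1 else 0

    agreements : ∀ {d} → Word d → Word d → ℕ
    agreements v w = sum λ j → match (v j) (w j)

    module _ (b : ℕ) {t : ℕ} (∑b^match≡t : ∀ a → sum (λ l → b ^ match l a) ≡ t) where

      open ≤-Reasoning

      -- Summing over all letters `l` replaces each factor `b ^ match l (a i)` by `t`, whatever
      -- `a i` is, so the cheapest letter costs at most the mean. The mean is multiplied out to stay
      -- within ℕ.
      ∃-letter : ∀ {n} (c : Vector ℕ n) (a : Vector Letter n) →
        ∃ λ l → suc q * sum (λ i → c i * b ^ match l (a i)) ≤ t * sum c
      ∃-letter c a with ∃-≤mean (λ l → sum λ i → c i * b ^ match l (a i))
      ... | l , qF≤ = l , (begin
        suc q * sum (λ i → c i * b ^ match l (a i))      ≤⟨ qF≤ ⟩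
        sum (λ l → sum λ i → c i * b ^ match l (a i))    ≡⟨ ∑-comm (λ l i → c i * b ^ match l (a i)) ⟩
        sum (λ i → sum λ l → c i * b ^ match l (a i))    ≡⟨ sum-cong-≗ (λ i → *-distribˡ-sum (c i) (λ l → b ^ match l (a i))) ⟨
        sum (λ i → c i * sum λ l → b ^ match l (a i))    ≡⟨ sum-cong-≗ (λ i → trans (cong (c i *_) (∑b^match≡t (a i))) (*-comm (c i) t)) ⟩
        sum (λ i → t * c i)                              ≡⟨ *-distribˡ-sum t c ⟨
        t * sum c                                        ∎)

      -- The method of conditional expectations. The weights `c` are arbitrary because, after a
      -- letter has been fixed, they absorb its factor `b ^ match` for each word.
      ∃-word : ∀ d {n} (c : Vector ℕ n) (s : Vector (Word d) n) →
        ∃ λ w → suc q ^ d * sum (λ i → c i * b ^ agreements w (s i)) ≤ t ^ d * sum c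
      ∃-word zero    c s = (λ ()) , ≤-reflexive (cong (1 *_) (sum-cong-≗ λ i → *-identityʳ (c i)))
      ∃-word (suc d) c s with ∃-letter c (head ∘ s)
      ... | l , q∑c′≤t∑c with ∃-word d (λ i → c i * b ^ match l (head (s i))) (tail ∘ s)
      ...   | w , ih = l Vector.∷ w , (begin
        suc q ^ suc d * sum (λ i → c i * b ^ (match l (head (s i)) + agreements w (tail (s i))))
          ≡⟨ *-assoc (suc q) (suc q ^ d) _ ⟩
        suc q * (suc q ^ d * sum (λ i → c i * b ^ (match l (head (s i)) + agreements w (tail (s i)))))
          ≡⟨ cong (λ x → suc q * (suc q ^ d * x)) (sum-cong-≗ λ i →
               trans (cong (c i *_) (^-distribˡ-+-* b (match l (head (s i))) _)) (sym (*-assoc (c i) _ _))) ⟩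
        suc q * (suc q ^ d * sum (λ i → c′ i * b ^ agreements w (tail (s i))))
          ≤⟨ *-monoʳ-≤ (suc q) ih ⟩
        suc q * (t ^ d * sum c′)
          ≡⟨ x∙yz≈y∙xz (suc q) (t ^ d) (sum c′) ⟩
        t ^ d * (suc q * sum c′)
          ≤⟨ *-monoʳ-≤ (t ^ d) q∑c′≤t∑c ⟩
        t ^ d * (t * sum c)
          ≡⟨ trans (x∙yz≈y∙xz (t ^ d) t (sum c)) (sym (*-assoc t (t ^ d) (sum c))) ⟩
        t ^ suc d * sum c
          ∎)
        where
        c′ = λ i → c i * b ^ match l (head (s i))

  open Alphabet 4 public using (Letter; Word; match; agreements)
  open Alphabet 4 using (∃-word)

  ∑32^match≡36 : ∀ a → sum (λ l → 32 ^ match l a) ≡ 36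
  ∑32^match≡36 zero                         = refl
  ∑32^match≡36 (suc zero)                   = refl
  ∑32^match≡36 (suc (suc zero))             = refl
  ∑32^match≡36 (suc (suc (suc zero)))       = refl
  ∑32^match≡36 (suc (suc (suc (suc zero)))) = refl

  -- A word s agreeing with w in at least 4d/5 places would contribute
  -- 32^(4d/5) = 16^d to the sum, but 5^d · 16^d > 36^d · 2^d.

  ∃-distant-word : ∀ d .{{_ : NonZero d}} (s : Vector (Word d) (2 ^ d)) →
    ∃ λ w → ∀ i → 5 * agreements w (s i) < 4 * d
  ∃-distant-word d s with ∃-word 32 ∑32^match≡36 d (Vector.replicate (2 ^ d) 1) s
  ... | w , 5^d∑≤36^d∑ = w , λ i → ≰⇒> λ 4d≤5a → <⇒≱ (^-monoˡ-< d 72<80) (begin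
    80 ^ d                                          ≡⟨ ^-distribʳ-* 5 16 d ⟩
    5 ^ d * 16 ^ d                                  ≡⟨ cong (5 ^ d *_) (^-*-assoc 2 4 d) ⟩
    5 ^ d * 2 ^ (4 * d)                             ≤⟨ *-monoʳ-≤ (5 ^ d) (^-monoʳ-≤ 2 4d≤5a) ⟩
    5 ^ d * 2 ^ (5 * agreements w (s i))            ≡⟨ cong (5 ^ d *_) (^-*-assoc 2 5 (agreements w (s i))) ⟨
    5 ^ d * 32 ^ agreements w (s i)                 ≡⟨ cong (5 ^ d *_) (*-identityˡ _) ⟨
    5 ^ d * (1 * 32 ^ agreements w (s i))           ≤⟨ *-monoʳ-≤ (5 ^ d) (term≤sum (λ i → 1 * 32 ^ agreements w (s i)) i) ⟩
    5 ^ d * sum (λ i → 1 * 32 ^ agreements w (s i)) ≤⟨ 5^d∑≤36^d∑ ⟩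
    36 ^ d * sum (Vector.replicate (2 ^ d) 1)              ≡⟨ cong (36 ^ d *_) (sum-1 (2 ^ d)) ⟩
    36 ^ d * 2 ^ d                                  ≡⟨ ^-distribʳ-* 36 2 d ⟨
    72 ^ d                                          ∎)
    where
    open ≤-Reasoning
    72<80 : 72 < 80
    72<80 = m≤m+n 73 7
    sum-1 : ∀ n → sum (Vector.replicate n 1) ≡ n
    sum-1 zero    = refl
    sum-1 (suc n) = cong suc (sum-1 n)

-- Absolute values, inner products and norms

module Euclidean (em : ExcludedMiddle 0ℓ) (R : CompleteOrderedField) where

  open OrderedField em R

  -- The bound `∣ x ∣ ≤ b` split into the two inequalities that `⊔-lub` recombines; in this form it
  -- can be certified by polynomial identities.
  Abs≤ : ℝ → ℝ → Set
  Abs≤ x b = x ≤ b ∧ - x ≤ b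

  -- Serves certificates that arise naturally for twice the wanted inequality. If `x ≤ 0`, then
  -- already `x + x ≤ x`.
  0≤2x⇒0≤x : ∀ {x} → 0# ≤ x + x → 0# ≤ x
  0≤2x⇒0≤x {x} 0≤2x with total 0# x
  ... | inj₁ 0≤x = 0≤x
  ... | inj₂ x≤0 = ≤-trans 0≤2x (≤-by (gap x≤0) (solve 1 (λ x → x :- (x :+ x) := con (+ 0) :- x) refl x))

  -- `2(ab - xy) = (a - x)(b + y) + (a + x)(b - y)`, and `2(ab + xy) = (a - x)(b - y) + (a + x)(b +
  -- y)`.
  Abs≤-* : ∀ {x y a b} → Abs≤ x a → Abs≤ y b → Abs≤ (x * y) (a * b)
  Abs≤-* {x} {y} {a} {b} (x≤a , -x≤a) (y≤b , -y≤b) =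
    ≤-by (0≤2x⇒0≤x (≤-respʳ-≈
      (solve 4 (λ x y a b → (a :- x) :* (b :- :- y) :+ (a :- :- x) :* (b :- y)
        := (a :* b :- x :* y) :+ (a :* b :- x :* y)) refl x y a b)
      (gap x≤a ⊛ gap -y≤b ⊕ gap -x≤a ⊛ gap y≤b))) refl ,
    ≤-by (0≤2x⇒0≤x (≤-respʳ-≈
      (solve 4 (λ x y a b → (a :- x) :* (b :- y) :+ (a :- :- x) :* (b :- :- y)
        := (a :* b :- :- (x :* y)) :+ (a :* b :- :- (x :* y))) refl x y a b)
      (gap x≤a ⊛ gap y≤b ⊕ gap -x≤a ⊛ gap -y≤b))) refl

  Abs≤⇒0≤bound : ∀ {x b} → Abs≤ x b → 0# ≤ b
  Abs≤⇒0≤bound {x} {b} (x≤b , -x≤b) = 0≤2x⇒0≤x (≤-respʳ-≈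
    (solve 2 (λ x b → (b :- x) :+ (b :- :- x) := b :+ b) refl x b) (gap x≤b ⊕ gap -x≤b))

  Abs≤-refl : ∀ {x} → 0# ≤ x → Abs≤ x x
  Abs≤-refl {x} 0≤x = ≤-refl , ≤-by (0≤x ⊕ 0≤x) (solve 1 (λ x → x :- :- x := x :+ x) refl x)

  Abs≤-cong : ∀ {x y b} → x ≈ y → Abs≤ x b → Abs≤ y b
  Abs≤-cong x≈y (x≤b , -x≤b) = ≤-respˡ-≈ x≈y x≤b , ≤-respˡ-≈ (-‿cong x≈y) -x≤b

  Abs≤-trans : ∀ {x a b} → Abs≤ x a → a ≤ b → Abs≤ x b
  Abs≤-trans (x≤a , -x≤a) a≤b = ≤-trans x≤a a≤b , ≤-trans -x≤a a≤b

  Abs≤-+ : ∀ {x y a b} → Abs≤ x a → Abs≤ y b → Abs≤ (x + y) (a + b)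
  Abs≤-+ {x} {y} {a} {b} (x≤a , -x≤a) (y≤b , -y≤b) =
    ≤-by (gap x≤a ⊕ gap y≤b) (solve 4 (λ x y a b → a :+ b :- (x :+ y) := (a :- x) :+ (b :- y)) refl x y a b) ,
    ≤-by (gap -x≤a ⊕ gap -y≤b) (solve 4 (λ x y a b → a :+ b :- :- (x :+ y) := (a :- :- x) :+ (b :- :- y)) refl x y a b)

  Abs≤-neg : ∀ {x b} → Abs≤ x b → Abs≤ (- x) b
  Abs≤-neg {x} (x≤b , -x≤b) = -x≤b , ≤-respˡ-≈ (solve 1 (λ x → x := :- :- x) refl x) x≤b

  0≤x≤b⇒Abs≤ : ∀ {x b} → 0# ≤ x → x ≤ b → Abs≤ x b
  0≤x≤b⇒Abs≤ 0≤x x≤b = Abs≤-trans (Abs≤-refl 0≤x) x≤b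

  ⟨⟩-cong : ∀ {d} {x x′ y y′ : ℝ^ d} → (∀ i → x i ≈ x′ i) → (∀ i → y i ≈ y′ i) → ⟨ x , y ⟩ ≈ ⟨ x′ , y′ ⟩
  ⟨⟩-cong {zero}  x≈ y≈ = refl
  ⟨⟩-cong {suc d} x≈ y≈ = +-cong (*-cong (x≈ zero) (y≈ zero)) (⟨⟩-cong (x≈ ∘ suc) (y≈ ∘ suc))

  ⟨⟩-comm : ∀ {d} (x y : ℝ^ d) → ⟨ x , y ⟩ ≈ ⟨ y , x ⟩
  ⟨⟩-comm {zero}  x y = refl
  ⟨⟩-comm {suc d} x y = +-cong (*-comm _ _) (⟨⟩-comm (tail x) (tail y))

  -- The combination is specified coordinatewise up to `≈`, so that any vector expression of this
  -- value can take the place of `z`.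
  ⟨⟩-linearˡ : ∀ {d} α β {x y z : ℝ^ d} (w : ℝ^ d) → (∀ i → z i ≈ α * x i + β * y i) →
    ⟨ z , w ⟩ ≈ α * ⟨ x , w ⟩ + β * ⟨ y , w ⟩
  ⟨⟩-linearˡ {zero}  α β w z≈ = solve 2 (λ α β → con (+ 0) := α :* con (+ 0) :+ β :* con (+ 0)) refl α β
  ⟨⟩-linearˡ {suc d} α β {x} {y} {z} w z≈ =
    trans (+-cong (*-congʳ (z≈ zero)) (⟨⟩-linearˡ α β (tail w) (z≈ ∘ suc)))
      (solve 7 (λ α β a b c X Y → (α :* a :+ β :* b) :* c :+ (α :* X :+ β :* Y)
        := α :* (a :* c :+ X) :+ β :* (b :* c :+ Y)) refl
        α β (head x) (head y) (head w) ⟨ tail x , tail w ⟩ ⟨ tail y , tail w ⟩)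

  ⟨⟩-linear² : ∀ {d} α β {x y z : ℝ^ d} → (∀ i → z i ≈ α * x i + β * y i) →
    ⟨ z , z ⟩ ≈ α * α * ⟨ x , x ⟩ + # 2 * (α * β * ⟨ x , y ⟩) + β * β * ⟨ y , y ⟩
  ⟨⟩-linear² α β {x} {y} {z} z≈ =
    trans (⟨⟩-linearˡ α β z z≈)
    (trans (+-cong (*-congˡ (trans (⟨⟩-comm x z) (⟨⟩-linearˡ α β x z≈)))
                   (*-congˡ (trans (⟨⟩-comm y z) (⟨⟩-linearˡ α β y z≈))))
    (trans (+-congʳ (*-congˡ (+-congˡ (*-congˡ (⟨⟩-comm y x)))))
      (solve 5 (λ α β X P Y → α :* (α :* X :+ β :* P) :+ β :* (α :* P :+ β :* Y)
        := α :* α :* X :+ con (+ 2) :* (α :* β :* P) :+ β :* β :* Y) refl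
        α β ⟨ x , x ⟩ ⟨ x , y ⟩ ⟨ y , y ⟩)))

  0≤⟨x,x⟩ : ∀ {d} (x : ℝ^ d) → 0# ≤ ⟨ x , x ⟩
  0≤⟨x,x⟩ {zero}  x = ≤-refl
  0≤⟨x,x⟩ {suc d} x = 0≤x² (head x) ⊕ 0≤⟨x,x⟩ (tail x)

  -- Induction on the dimension: adding the coordinates a and b to x and y
  -- increases ⟨x,x⟩⟨y,y⟩ - ⟨x,y⟩² by the squared norm of a y - b x.

  cauchy-schwarz : ∀ {d} (x y : ℝ^ d) → ⟨ x , y ⟩ * ⟨ x , y ⟩ ≤ ⟨ x , x ⟩ * ⟨ y , y ⟩
  cauchy-schwarz {zero}  x y = ≤-refl
  cauchy-schwarz {suc d} x y = ≤-by (0≤⟨x,x⟩ z ⊕ gap (cauchy-schwarz (tail x) (tail y)))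
    (trans (solve 5 (λ a b X Y P → (a :* a :+ X) :* (b :* b :+ Y) :- (a :* b :+ P) :* (a :* b :+ P)
        := (a :* a :* Y :+ con (+ 2) :* (a :* (:- b) :* P) :+ (:- b) :* (:- b) :* X) :+ (X :* Y :- P :* P)) refl
        (head x) (head y) ⟨ tail x , tail x ⟩ ⟨ tail y , tail y ⟩ ⟨ tail x , tail y ⟩)
      (+-congʳ (sym (trans (⟨⟩-linear² (head x) (- head y) {tail y} {tail x} {z} λ i → refl)
        (+-congʳ (+-congˡ (*-congˡ (*-congˡ (⟨⟩-comm (tail y) (tail x))))))))))
    where
    z : ℝ^ d
    z i = head x * tail y i + - head y * tail x i

  ‖x‖*‖x‖≈⟨x,x⟩ : ∀ {d} (x : ℝ^ d) → ‖ x ‖ * ‖ x ‖ ≈ ⟨ x , x ⟩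
  ‖x‖*‖x‖≈⟨x,x⟩ x = √s*√s≈s (0≤⟨x,x⟩ x)

  0≤‖x‖ : ∀ {d} (x : ℝ^ d) → 0# ≤ ‖ x ‖
  0≤‖x‖ x = √-nonNegative ⟨ x , x ⟩

  ‖x‖≤ : ∀ {d} (x : ℝ^ d) {b} → 0# ≤ b → ⟨ x , x ⟩ ≤ b * b → ‖ x ‖ ≤ b
  ‖x‖≤ x 0≤b ⟨x,x⟩≤b² = x²≤y²⇒x≤y 0≤b (≤-respˡ-≈ (sym (‖x‖*‖x‖≈⟨x,x⟩ x)) ⟨x,x⟩≤b²)

  ⟨x,y⟩≤‖x‖*‖y‖ : ∀ {d} (x y : ℝ^ d) → Abs≤ ⟨ x , y ⟩ (‖ x ‖ * ‖ y ‖)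
  ⟨x,y⟩≤‖x‖*‖y‖ x y =
    x²≤y²⇒x≤y (0≤‖x‖ x ⊛ 0≤‖x‖ y) p²≤ ,
    x²≤y²⇒x≤y (0≤‖x‖ x ⊛ 0≤‖x‖ y) (≤-respˡ-≈ (solve 1 (λ p → p :* p := (:- p) :* (:- p)) refl ⟨ x , y ⟩) p²≤)
    where
    p²≤ : ⟨ x , y ⟩ * ⟨ x , y ⟩ ≤ ‖ x ‖ * ‖ y ‖ * (‖ x ‖ * ‖ y ‖)
    p²≤ = ≤-respʳ-≈ (trans (sym (*-cong (‖x‖*‖x‖≈⟨x,x⟩ x) (‖x‖*‖x‖≈⟨x,x⟩ y)))
      (solve 2 (λ x y → x :* x :* (y :* y) := x :* y :* (x :* y)) refl ‖ x ‖ ‖ y ‖)) (cauchy-schwarz x y)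

  -- The squares of both sides are compared term by term, the mixed term by Cauchy-Schwarz.
  ‖αx+βy‖≤ : ∀ {d} {α β a b} {x y z : ℝ^ d} → Abs≤ α a → Abs≤ β b → (∀ i → z i ≈ α * x i + β * y i) →
    ‖ z ‖ ≤ a * ‖ x ‖ + b * ‖ y ‖
  ‖αx+βy‖≤ {α = α} {β} {a} {b} {x} {y} {z} |α|≤a |β|≤b z≈ =
    ‖x‖≤ z (Abs≤⇒0≤bound |α|≤a ⊛ 0≤‖x‖ x ⊕ Abs≤⇒0≤bound |β|≤b ⊛ 0≤‖x‖ y)
      (≤-by (gap (proj₁ (Abs≤-* |α|≤a |α|≤a)) ⊛ 0≤⟨x,x⟩ x
          ⊕ 0≤# 2 ⊛ gap (proj₁ (Abs≤-* (Abs≤-* |α|≤a |β|≤b) (⟨x,y⟩≤‖x‖*‖y‖ x y)))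
          ⊕ gap (proj₁ (Abs≤-* |β|≤b |β|≤b)) ⊛ 0≤⟨x,x⟩ y)
        (trans (+-cong
          (trans (solve 4 (λ a b m n → (a :* m :+ b :* n) :* (a :* m :+ b :* n)
            := a :* a :* (m :* m) :+ con (+ 2) :* (a :* b :* (m :* n)) :+ b :* b :* (n :* n)) refl a b ‖ x ‖ ‖ y ‖)
            (+-cong (+-congʳ (*-congˡ (‖x‖*‖x‖≈⟨x,x⟩ x))) (*-congˡ (‖x‖*‖x‖≈⟨x,x⟩ y))))
          (-‿cong (⟨⟩-linear² α β z≈)))
          (solve 8 (λ a b α β X Y M P →
            a :* a :* X :+ con (+ 2) :* (a :* b :* M) :+ b :* b :* Y :-
              (α :* α :* X :+ con (+ 2) :* (α :* β :* P) :+ β :* β :* Y)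
            := (a :* a :- α :* α) :* X :+ (con (+ 2) :* (a :* b :* M :- α :* β :* P) :+ (b :* b :- β :* β) :* Y)) refl
            a b α β ⟨ x , x ⟩ ⟨ y , y ⟩ (‖ x ‖ * ‖ y ‖) ⟨ x , y ⟩)))

  ‖-‖-triangle : ∀ {d} {x y z : ℝ^ d} → (∀ i → z i ≈ x i + y i) → ‖ z ‖ ≤ ‖ x ‖ + ‖ y ‖
  ‖-‖-triangle {x = x} {y} {z} z≈ = ≤-respʳ-≈ (+-cong (*-identityˡ _) (*-identityˡ _))
    (‖αx+βy‖≤ (Abs≤-refl 0≤1) (Abs≤-refl 0≤1)
      λ i → trans (z≈ i) (sym (+-cong (*-identityˡ _) (*-identityˡ _))))

  ‖x-y‖≤‖y-x‖ : ∀ {d} (x y : ℝ^ d) → ‖ x -ᵛ y ‖ ≤ ‖ y -ᵛ x ‖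
  ‖x-y‖≤‖y-x‖ x y = ‖x‖≤ (x -ᵛ y) (0≤‖x‖ (y -ᵛ x)) (≤-reflexive (trans (swap x y) (sym (‖x‖*‖x‖≈⟨x,x⟩ (y -ᵛ x)))))
    where
    swap : ∀ {d} (x y : ℝ^ d) → ⟨ x -ᵛ y , x -ᵛ y ⟩ ≈ ⟨ y -ᵛ x , y -ᵛ x ⟩
    swap {zero}  x y = refl
    swap {suc d} x y = +-cong (solve 2 (λ x y → (x :- y) :* (x :- y) := (y :- x) :* (y :- x)) refl (head x) (head y))
      (swap (tail x) (tail y))

  -- By the parallelogram law the two sides differ by the squared norm of `(z - x) + (z - y)`.
  parallelogram-≤ : ∀ {d} (x y z : ℝ^ d) → ⟨ x -ᵛ y , x -ᵛ y ⟩ ≤ # 2 * (⟨ z -ᵛ x , z -ᵛ x ⟩ + ⟨ z -ᵛ y , z -ᵛ y ⟩)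
  parallelogram-≤ {zero}  x y z = ≤-by ≤-refl (solve 0 (con (+ 2) :* (con (+ 0) :+ con (+ 0)) :- con (+ 0) := con (+ 0)) refl)
  parallelogram-≤ {suc d} x y z = ≤-by (0≤x² (head z - head x + (head z - head y)) ⊕ gap (parallelogram-≤ (tail x) (tail y) (tail z)))
    (solve 6 (λ a b c X Y D → con (+ 2) :* (((c :- a) :* (c :- a) :+ X) :+ ((c :- b) :* (c :- b) :+ Y)) :- ((a :- b) :* (a :- b) :+ D)
      := (c :- a :+ (c :- b)) :* (c :- a :+ (c :- b)) :+ (con (+ 2) :* (X :+ Y) :- D)) refl
      (head x) (head y) (head z) _ _ _)

  identityMatrix : ∀ {d} → Matrix d d
  identityMatrix zero    zero    = 1#
  identityMatrix (suc i) (suc j) = identityMatrix i j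
  identityMatrix _       _       = 0#

  ⟨0,x⟩≈0 : ∀ {d} (x : ℝ^ d) → ⟨ (λ _ → 0#) , x ⟩ ≈ 0#
  ⟨0,x⟩≈0 {zero}  x = refl
  ⟨0,x⟩≈0 {suc d} x = trans (+-cong (zeroˡ _) (⟨0,x⟩≈0 (tail x))) (+-identityˡ 0#)

  identityMatrix-*ᵛ : ∀ {d} (x : ℝ^ d) i → (identityMatrix *ᵛ x) i ≈ x i
  identityMatrix-*ᵛ x zero    = trans (+-cong (*-identityˡ _) (⟨0,x⟩≈0 (tail x))) (+-identityʳ _)
  identityMatrix-*ᵛ x (suc i) = trans (+-cong (zeroˡ _) (identityMatrix-*ᵛ (tail x) i)) (+-identityˡ _)

-- The bump function and its first two derivatives

module Bumps (em : ExcludedMiddle 0ℓ) (R : CompleteOrderedField) where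

  open OrderedField em R
  open Euclidean em R

  infix 10 _⁺

  _⁺ : ℝ → ℝ
  p ⁺ = p ⊔ 0#

  0≤p⁺ : ∀ p → 0# ≤ p ⁺
  0≤p⁺ p = x≤y⊔x p 0#

  p≤p⁺ : ∀ p → p ≤ p ⁺
  p≤p⁺ p = x≤x⊔y p 0#

  0≤p⇒p⁺≈p : ∀ {p} → 0# ≤ p → p ⁺ ≈ p
  0≤p⇒p⁺≈p {p} 0≤p = antisym (⊔-lub ≤-refl 0≤p) (p≤p⁺ p)

  p≤0⇒p⁺≈0 : ∀ {p} → p ≤ 0# → p ⁺ ≈ 0#
  p≤0⇒p⁺≈0 {p} p≤0 = antisym (⊔-lub p≤0 ≤-refl) (0≤p⁺ p)

  -- With `0 ≤ p⁺` and `p ≤ p⁺` this determines the positive part, which spares the Taylor estimates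
  -- a case distinction on signs.
  p⁺-complementary : ∀ p → p ⁺ * (p ⁺ - p) ≈ 0#
  p⁺-complementary p with ⊔-sel p 0#
  ... | inj₁ p⁺≈p = trans (*-congˡ (trans (+-congʳ p⁺≈p) (-‿inverseʳ p))) (zeroʳ _)
  ... | inj₂ p⁺≈0 = trans (*-congʳ p⁺≈0) (zeroˡ _)

  -- Lets a multiple of a vanishing product enter a nonnegativity certificate, whatever the sign of
  -- its coefficient.
  0≤*≈0 : ∀ k {z} → z ≈ 0# → 0# ≤ k * z
  0≤*≈0 k z≈0 = ≤-reflexive (sym (trans (*-congˡ z≈0) (zeroʳ k)))

  module Taylor (p q : ℝ) where

    private
      P = p ⁺
      Q = q ⁺
      0≤P = 0≤p⁺ p
      0≤Q = 0≤p⁺ q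
      0≤r = gap (p≤p⁺ p)
      0≤s = gap (p≤p⁺ q)
      Pr≈0 = p⁺-complementary p
      Qs≈0 = p⁺-complementary q

    -- The remainders at `q` of the first-order Taylor expansions about `p` of the cube and the
    -- square of the positive part.
    cubeRemainder squareRemainder : ℝ
    cubeRemainder   = Q * Q * Q - P * P * P - # 3 * (P * P * (q - p))
    squareRemainder = Q * Q - P * P - # 2 * (P * (q - p))

    -- With r = p⁺ - p and s = q⁺ - q all four bounds are polynomial
    -- identities modulo p⁺ r = 0 = q⁺ s.

    0≤cubeRemainder : 0# ≤ cubeRemainder
    0≤cubeRemainder = ≤-by
      (0≤x² (Q - P) ⊛ (0≤Q ⊕ 0≤# 2 ⊛ 0≤P) ⊕ 0≤# 3 ⊛ (0≤P ⊛ 0≤P) ⊛ 0≤s ⊕ 0≤*≈0 (- (# 3 * P)) Pr≈0)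
      (solve 4 (λ p q P Q → Q :* Q :* Q :- P :* P :* P :- con (+ 3) :* (P :* P :* (q :- p)) :- con (+ 0)
        := (Q :- P) :* (Q :- P) :* (Q :+ con (+ 2) :* P) :+ (con (+ 3) :* ((P :* P) :* (Q :- q))
          :+ (:- (con (+ 3) :* P)) :* (P :* (P :- p)))) refl p q P Q)

    cubeRemainder≤ : cubeRemainder ≤ (q - p) * (q - p) * (Q + # 2 * P)
    cubeRemainder≤ = ≤-by
      (0≤# 2 ⊛ (0≤Q ⊛ 0≤Q) ⊛ 0≤r ⊕ (0≤P ⊛ 0≤P) ⊛ 0≤s ⊕ (0≤Q ⊕ 0≤# 2 ⊛ 0≤P) ⊛ 0≤x² (P - p - (Q - q))
        ⊕ 0≤*≈0 (# 2 * Q - P) Pr≈0 ⊕ 0≤*≈0 (- (# 2 * (Q + P))) Qs≈0)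
      (solve 4 (λ p q P Q → (q :- p) :* (q :- p) :* (Q :+ con (+ 2) :* P)
          :- (Q :* Q :* Q :- P :* P :* P :- con (+ 3) :* (P :* P :* (q :- p)))
        := con (+ 2) :* ((Q :* Q) :* (P :- p)) :+ ((P :* P) :* (Q :- q)
          :+ ((Q :+ con (+ 2) :* P) :* ((P :- p :- (Q :- q)) :* (P :- p :- (Q :- q)))
          :+ ((con (+ 2) :* Q :- P) :* (P :* (P :- p)) :+ (:- (con (+ 2) :* (Q :+ P))) :* (Q :* (Q :- q)))))) refl p q P Q)

    0≤squareRemainder : 0# ≤ squareRemainder
    0≤squareRemainder = ≤-by
      (0≤x² (Q - P) ⊕ 0≤# 2 ⊛ 0≤P ⊛ 0≤s ⊕ 0≤*≈0 (- # 2) Pr≈0)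
      (solve 4 (λ p q P Q → Q :* Q :- P :* P :- con (+ 2) :* (P :* (q :- p)) :- con (+ 0)
        := (Q :- P) :* (Q :- P) :+ (con (+ 2) :* (P :* (Q :- q)) :+ (:- con (+ 2)) :* (P :* (P :- p)))) refl p q P Q)

    squareRemainder≤ : squareRemainder ≤ (q - p) * (q - p)
    squareRemainder≤ = ≤-by
      (0≤# 2 ⊛ 0≤Q ⊛ 0≤r ⊕ 0≤x² (P - p - (Q - q)) ⊕ 0≤*≈0 (- # 2) Qs≈0)
      (solve 4 (λ p q P Q → (q :- p) :* (q :- p) :- (Q :* Q :- P :* P :- con (+ 2) :* (P :* (q :- p)))
        := con (+ 2) :* (Q :* (P :- p)) :+ ((P :- p :- (Q :- q)) :* (P :- p :- (Q :- q))
          :+ (:- con (+ 2)) :* (Q :* (Q :- q)))) refl p q P Q)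

  ⅓ : ℝ
  ⅓ = fromℕ 3 ⁻¹

  1≤fromℕ3 : 1# ≤ fromℕ 3
  1≤fromℕ3 = ≤-respʳ-≈ (sym (fromℕ≈# 3)) (#-mono {1} {3} (s≤s z≤n))

  0≤⅓ : 0# ≤ ⅓
  0≤⅓ = 0≤x⁻¹ 1≤fromℕ3

  3*⅓≈1 : # 3 * ⅓ ≈ 1#
  3*⅓≈1 = trans (*-congʳ (sym (fromℕ≈# 3))) (⁻¹-inverseʳ (fromℕ 3) (1≤x⇒x≉0 1≤fromℕ3))

  module Bump {d : ℕ} (c : ℝ^ d) where

    profile : ℝ^ d → ℝ
    profile x = 1# - ⟨ x -ᵛ c , x -ᵛ c ⟩

    cap : ℝ^ d → ℝ
    cap x = profile x ⁺

    -- The cube is the lowest whole power of the positive part that is twice differentiable at the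
    -- kink.
    f : ℝ^ d → ℝ
    f x = - (⅓ * (cap x * cap x * cap x))

    ∇f : ℝ^ d → ℝ^ d
    ∇f x i = # 2 * (cap x * cap x) * (x i - c i)

    -- Product rule: since `profile` has gradient `-2(x - c)`, the factor `2 cap²` has gradient
    -- `-8 cap (x - c)` and contributes the rank-one term.
    ∇²f : ℝ^ d → Matrix d d
    ∇²f x i j = # 2 * (cap x * cap x) * identityMatrix i j + - (# 8 * cap x * (x i - c i)) * (x j - c j)

    0≤cap : ∀ x → 0# ≤ cap x
    0≤cap x = 0≤p⁺ (profile x)

    cap≤1 : ∀ x → cap x ≤ 1#
    cap≤1 x = ⊔-lub (≤-by (0≤⟨x,x⟩ (x -ᵛ c))
      (solve 1 (λ u → con (+ 1) :- (con (+ 1) :- u) := u) refl ⟨ x -ᵛ c , x -ᵛ c ⟩)) 0≤1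

    module Estimate (x y : ℝ^ d) (n≤1 : ‖ y -ᵛ x ‖ ≤ 1#) where

      open Taylor (profile x) (profile y)

      private
        v = x -ᵛ c
        w = y -ᵛ c
        h = y -ᵛ x
        n = ‖ h ‖
        V = ‖ v ‖
        P = cap x
        Q = cap y
        i = ⟨ v , h ⟩
        D = ⟨ h , h ⟩
        0≤n = 0≤‖x‖ h
        0≤V = 0≤‖x‖ v
        0≤P = 0≤cap x
        P≤1 = cap≤1 x
        Q≤1 = cap≤1 y
        w≈v+h : ∀ j → w j ≈ v j + h j
        w≈v+h j = solve 3 (λ x y c → y :- c := x :- c :+ (y :- x)) refl (x j) (y j) (c j)
        -- The increment of `profile` is `-(2i + D)`, and `D = n² ≤ n` because `n ≤ 1`; so `M * n`
        -- bounds its absolute value.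
        M = # 2 * V + 1#
        m = profile y - profile x

        0≤M : 0# ≤ M
        0≤M = 0≤# 2 ⊛ 0≤V ⊕ 0≤1

        D≈nn : D ≈ n * n
        D≈nn = sym (‖x‖*‖x‖≈⟨x,x⟩ h)

        m≈ : m ≈ - (# 2 * i + D)
        m≈ = trans (+-congʳ (+-congˡ (-‿cong (⟨⟩-linear² 1# 1# {v} {h} {w}
            λ j → trans (w≈v+h j) (sym (+-cong (*-identityˡ _) (*-identityˡ _)))))))
          (solve 3 (λ X i D → (con (+ 1) :- (con (+ 1) :* con (+ 1) :* X :+ con (+ 2) :* (con (+ 1) :* con (+ 1) :* i)
            :+ con (+ 1) :* con (+ 1) :* D)) :- (con (+ 1) :- X) := :- (con (+ 2) :* i :+ D)) refl ⟨ v , v ⟩ i D)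

        |i|≤Vn : Abs≤ i (V * n)
        |i|≤Vn = ⟨x,y⟩≤‖x‖*‖y‖ v h

        |m|≤Mn : Abs≤ m (M * n)
        |m|≤Mn = Abs≤-cong (sym m≈) (Abs≤-neg (Abs≤-trans
          (Abs≤-+ (Abs≤-* (Abs≤-refl (0≤# 2)) |i|≤Vn) (Abs≤-refl (0≤⟨x,x⟩ h)))
          (≤-by (0≤n ⊛ gap n≤1) (trans (+-congˡ (-‿cong (+-congˡ D≈nn)))
            (solve 2 (λ V n → (con (+ 2) :* V :+ con (+ 1)) :* n :- (con (+ 2) :* (V :* n) :+ n :* n)
              := n :* (con (+ 1) :- n)) refl V n)))))

        m²≤ : m * m ≤ M * n * (M * n)
        m²≤ = proj₁ (Abs≤-* |m|≤Mn |m|≤Mn)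

      gradientRemainder : ℝ
      gradientRemainder = (f y - f x) - ⟨ ∇f x , h ⟩

      -- The term `2i` of the increment of `profile` cancels against `∇f x`; what remains is the
      -- Taylor error of the cube and the quadratic part `D`.
      gradientRemainder≈ : gradientRemainder ≈ - (⅓ * cubeRemainder) + P * P * (n * n)
      gradientRemainder≈ =
        trans (+-congˡ (-‿cong (⟨⟩-linearˡ (# 2 * (P * P)) 0# {v} {v} {∇f x} h
          λ j → sym (trans (+-congˡ (zeroˡ _)) (+-identityʳ _)))))
        (trans (solve 6 (λ t P Q p q i → :- (t :* (Q :* Q :* Q)) :- :- (t :* (P :* P :* P))
              :- (con (+ 2) :* (P :* P) :* i :+ con (+ 0) :* i)
            := :- (t :* (Q :* Q :* Q :- P :* P :* P :- con (+ 3) :* (P :* P :* (q :- p))))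
              :- con (+ 3) :* t :* (P :* P :* (q :- p)) :- con (+ 2) :* (P :* P) :* i) refl ⅓ P Q (profile x) (profile y) i)
        (trans (+-congʳ (+-congˡ (-‿cong (*-cong 3*⅓≈1 (*-congˡ m≈)))))
        (trans (solve 4 (λ r P i D → r :- con (+ 1) :* (P :* P :* :- (con (+ 2) :* i :+ D)) :- con (+ 2) :* (P :* P) :* i
            := r :+ P :* P :* D) refl (- (⅓ * cubeRemainder)) P i D)
        (+-congˡ (*-congˡ D≈nn)))))

      -- From above, the cube remainder is dropped and `P ≤ 1 ≤ M` is used. From below, a third of
      -- that remainder is at most `⅓ m² (Q + 2P) ≤ m²`.
      gradient-quadratic : Abs≤ gradientRemainder (M * M * (n * n))
      gradient-quadratic = Abs≤-cong (sym gradientRemainder≈)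
        ( ≤-by ((0≤# 4 ⊛ 0≤V ⊛ (0≤V ⊕ 0≤1)) ⊛ 0≤n ⊛ 0≤n ⊕ ((0≤1 ⊕ 0≤P) ⊛ gap P≤1) ⊛ 0≤n ⊛ 0≤n ⊕ 0≤⅓ ⊛ 0≤cubeRemainder)
            (solve 5 (λ V n t P r → (con (+ 2) :* V :+ con (+ 1)) :* (con (+ 2) :* V :+ con (+ 1)) :* (n :* n)
                :- (:- (t :* r) :+ P :* P :* (n :* n))
              := (con (+ 4) :* (V :* (V :+ con (+ 1)))) :* (n :* n)
                :+ (((con (+ 1) :+ P) :* (con (+ 1) :- P)) :* (n :* n) :+ t :* r)) refl V n ⅓ P cubeRemainder)
        , ≤-by (gap m²≤ ⊕ 0≤⅓ ⊛ gap cubeRemainder≤ ⊕ 0≤⅓ ⊛ 0≤x² m ⊛ (gap Q≤1 ⊕ 0≤# 2 ⊛ gap P≤1) ⊕ (0≤P ⊛ 0≤P) ⊛ 0≤n ⊛ 0≤n)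
            (trans (solve 7 (λ M n t P Q r m →
                M :* M :* (n :* n) :- :- (:- (t :* r) :+ P :* P :* (n :* n))
                := (M :* n :* (M :* n) :- con (+ 1) :* (m :* m)) :+ (m :* m :- t :* r :+ P :* P :* (n :* n)))
                refl M n ⅓ P Q cubeRemainder m)
            (trans (+-cong (+-congˡ (-‿cong (*-identityˡ _)))
                (+-congʳ (+-congʳ (trans (sym (*-identityˡ _)) (*-congʳ (sym 3*⅓≈1))))))
            (solve 7 (λ a n t P Q r m → a :+ (con (+ 3) :* t :* (m :* m) :- t :* r :+ P :* P :* (n :* n))
                := a :+ (t :* (m :* m :* (Q :+ con (+ 2) :* P) :- r)
                  :+ (t :* (m :* m :* ((con (+ 1) :- Q) :+ con (+ 2) :* (con (+ 1) :- P))) :+ P :* P :* (n :* n))))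
                refl (M * n * (M * n) - m * m) n ⅓ P Q cubeRemainder m))))

      -- Divided by `n²`, the sum of the bounds `8Vn · n` for `α h` and `(4 + 2M²)n² (V + 1)` for
      -- `β w`, where `‖ w ‖ ≤ V + n ≤ V + 1`.
      hessianConstant : ℝ
      hessianConstant = # 8 * V + (# 4 + # 2 * (M * M)) * (V + 1#)

      hessian-quadratic : ‖ (∇f y -ᵛ ∇f x) -ᵛ (∇²f x *ᵛ h) ‖ ≤ hessianConstant * (n * n)
      hessian-quadratic = ≤-trans (‖αx+βy‖≤ |α|≤a |β|≤b remainder≈) (≤-by
        (((0≤# 4 ⊛ 0≤n ⊛ 0≤n) ⊕ 0≤# 2 ⊛ (0≤M ⊛ 0≤n) ⊛ (0≤M ⊛ 0≤n)) ⊛ (gap (‖-‖-triangle w≈v+h) ⊕ gap n≤1))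
        (trans (+-congˡ (-‿cong (+-congˡ (*-congʳ (+-congʳ (*-congˡ (*-congˡ D≈nn)))))))
          (solve 4 (λ V M n W → (con (+ 8) :* V :+ (con (+ 4) :+ con (+ 2) :* (M :* M)) :* (V :+ con (+ 1))) :* (n :* n)
              :- (con (+ 8) :* (con (+ 1) :* (V :* n)) :* n
                :+ (con (+ 4) :* (con (+ 1) :* (n :* n)) :+ con (+ 2) :* (M :* n :* (M :* n))) :* W)
            := (con (+ 4) :* (n :* n) :+ con (+ 2) :* (M :* n :* (M :* n))) :* ((V :+ n :- W) :+ (con (+ 1) :- n)))
            refl V M n ‖ w ‖)))
        where
        |P|≤1 = 0≤x≤b⇒Abs≤ 0≤P P≤1
        -- Substituting `v = w - h`, the remainder is `-8Pi h + (2Q² - 2P² + 8Pi) w`. The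
        -- coefficient of `w` is twice the square remainder minus `4PD`, hence also quadratic in
        -- `n`.
        α = - (# 8 * (P * i))
        β = - (# 4 * (P * D)) + # 2 * (Q * Q - P * P - # 2 * (P * - (# 2 * i + D)))

        |α|≤a : Abs≤ α (# 8 * (1# * (V * n)))
        |α|≤a = Abs≤-neg (Abs≤-* (Abs≤-refl (0≤# 8)) (Abs≤-* |P|≤1 |i|≤Vn))

        |β|≤b : Abs≤ β (# 4 * (1# * D) + # 2 * (M * n * (M * n)))
        |β|≤b = Abs≤-+ (Abs≤-neg (Abs≤-* (Abs≤-refl (0≤# 4)) (Abs≤-* |P|≤1 (Abs≤-refl (0≤⟨x,x⟩ h)))))
          (Abs≤-* (Abs≤-refl (0≤# 2)) (Abs≤-cong (+-congˡ (-‿cong (*-congˡ (*-congˡ m≈))))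
            (0≤x≤b⇒Abs≤ 0≤squareRemainder (≤-trans squareRemainder≤ m²≤))))

        remainder≈ : ∀ j → ((∇f y -ᵛ ∇f x) -ᵛ (∇²f x *ᵛ h)) j ≈ α * h j + β * w j
        remainder≈ j = trans (+-congˡ (-‿cong (trans
            (⟨⟩-linearˡ (# 2 * (P * P)) (- (# 8 * P * v j)) {identityMatrix j} {v} {∇²f x j} h λ k → refl)
            (+-congʳ (*-congˡ (identityMatrix-*ᵛ h j))))))
          (solve 7 (λ P Q x y c i D →
              con (+ 2) :* (Q :* Q) :* (y :- c) :- con (+ 2) :* (P :* P) :* (x :- c)
                :- (con (+ 2) :* (P :* P) :* (y :- x) :+ :- (con (+ 8) :* P :* (x :- c)) :* i)
            := :- (con (+ 8) :* (P :* i)) :* (y :- x)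
              :+ (:- (con (+ 4) :* (P :* D)) :+ con (+ 2) :* (Q :* Q :- P :* P :- con (+ 2) :* (P :* :- (con (+ 2) :* i :+ D)))) :* (y :- c))
            refl P Q (x j) (y j) (c j) i D)

    isGradient : IsGradient f ∇f
    isGradient x ε 0<ε =
      let δ , 0<δ , small = quadratic⇒small 1≤K 0<ε in
      δ , 0<δ , λ y n<δ →
        let n≤1 , Kn²≤εn = small ‖ y -ᵛ x ‖ (0≤‖x‖ (y -ᵛ x)) n<δ
            E≤ , -E≤ = Estimate.gradient-quadratic x y n≤1
        in ⊔-lub (≤-trans E≤ Kn²≤εn) (≤-trans -E≤ Kn²≤εn)
      where
      V = ‖ x -ᵛ c ‖
      K = (# 2 * V + 1#) * (# 2 * V + 1#)
      1≤K : 1# ≤ K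
      1≤K = ≤-by (0≤# 4 ⊛ 0≤‖x‖ (x -ᵛ c) ⊛ (0≤‖x‖ (x -ᵛ c) ⊕ 0≤1))
        (solve 1 (λ V → (con (+ 2) :* V :+ con (+ 1)) :* (con (+ 2) :* V :+ con (+ 1)) :- con (+ 1)
          := con (+ 4) :* (V :* (V :+ con (+ 1)))) refl V)

    isHessian : IsJacobian ∇f ∇²f
    isHessian x ε 0<ε =
      let δ , 0<δ , small = quadratic⇒small 1≤K 0<ε in
      δ , 0<δ , λ y n<δ →
        let n≤1 , Kn²≤εn = small ‖ y -ᵛ x ‖ (0≤‖x‖ (y -ᵛ x)) n<δ
        in ≤-trans (Estimate.hessian-quadratic x y n≤1) Kn²≤εn
      where
      V = ‖ x -ᵛ c ‖
      0≤V = 0≤‖x‖ (x -ᵛ c)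
      M = # 2 * V + 1#
      K = # 8 * V + (# 4 + # 2 * (M * M)) * (V + 1#)
      1≤K : 1# ≤ K
      1≤K = ≤-by (0≤# 12 ⊛ 0≤V ⊕ 0≤# 3 ⊕ 0≤# 2 ⊛ 0≤x² M ⊛ (0≤V ⊕ 0≤1))
        (solve 2 (λ V M → con (+ 8) :* V :+ (con (+ 4) :+ con (+ 2) :* (M :* M)) :* (V :+ con (+ 1)) :- con (+ 1)
          := con (+ 12) :* V :+ (con (+ 3) :+ con (+ 2) :* (M :* M :* (V :+ con (+ 1))))) refl V M)

-- Lipschitz constants of the bump and its gradient

module BumpLipschitz (em : ExcludedMiddle 0ℓ) (R : CompleteOrderedField) where

  open OrderedField em R
  open Euclidean em R
  open Bumps em R

  -- The graph of `min(t, 1)`, given as the case distinction that the proofs need.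
  Clamp : ℝ → ℝ → Set
  Clamp t s = (t ≤ 1# ∧ s ≈ t) ⊎ (1# ≤ t ∧ s ≈ 1#)

  0≤clamp : ∀ {t s} → 0# ≤ t → Clamp t s → 0# ≤ s
  0≤clamp 0≤t (inj₁ (_ , s≈t)) = ≤-respʳ-≈ (sym s≈t) 0≤t
  0≤clamp 0≤t (inj₂ (_ , s≈1)) = ≤-respʳ-≈ (sym s≈1) 0≤1

  clamp≤1 : ∀ {t s} → Clamp t s → s ≤ 1#
  clamp≤1 (inj₁ (t≤1 , s≈t)) = ≤-respˡ-≈ (sym s≈t) t≤1
  clamp≤1 (inj₂ (_ , s≈1))   = ≤-reflexive s≈1

  clamp-mono : ∀ {t₁ t₂ s₁ s₂} → t₁ ≤ t₂ → Clamp t₁ s₁ → Clamp t₂ s₂ → s₁ ≤ s₂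
  clamp-mono t₁≤t₂ (inj₁ (_ , s₁≈t₁)) (inj₁ (_ , s₂≈t₂)) = ≤-respˡ-≈ (sym s₁≈t₁) (≤-respʳ-≈ (sym s₂≈t₂) t₁≤t₂)
  clamp-mono t₁≤t₂ (inj₂ (1≤t₁ , s₁≈1)) (inj₁ (_ , s₂≈t₂)) =
    ≤-respˡ-≈ (sym s₁≈1) (≤-respʳ-≈ (sym s₂≈t₂) (≤-trans 1≤t₁ t₁≤t₂))
  clamp-mono t₁≤t₂ c₁ (inj₂ (_ , s₂≈1)) = ≤-respʳ-≈ (sym s₂≈1) (clamp≤1 c₁)

  clamp-nonexpansive : ∀ {t₁ t₂ s₁ s₂} → t₁ ≤ t₂ → Clamp t₁ s₁ → Clamp t₂ s₂ → s₂ - s₁ ≤ t₂ - t₁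
  clamp-nonexpansive {t₁} {t₂} {s₁} {s₂} t₁≤t₂ (inj₁ (_ , s₁≈t₁)) c₂ = +-cong-≤ (s₂≤t₂ c₂)
    where
    s₂≤t₂ : Clamp t₂ s₂ → s₂ ≤ t₂
    s₂≤t₂ (inj₁ (_ , s₂≈t₂))   = ≤-reflexive s₂≈t₂
    s₂≤t₂ (inj₂ (1≤t₂ , s₂≈1)) = ≤-respˡ-≈ (sym s₂≈1) 1≤t₂
    +-cong-≤ : s₂ ≤ t₂ → s₂ - s₁ ≤ t₂ - t₁
    +-cong-≤ s₂≤t₂ = ≤-respʳ-≈ (+-congˡ (-‿cong s₁≈t₁)) (+-monoˡ-≤ (- s₁) s₂≤t₂)
  clamp-nonexpansive {t₁} {t₂} {s₁} {s₂} t₁≤t₂ (inj₂ (_ , s₁≈1)) c₂ =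
    ≤-by (gap t₁≤t₂ ⊕ gap (clamp≤1 c₂)) (trans (+-congˡ (-‿cong (+-congˡ (-‿cong s₁≈1))))
      (solve 3 (λ t₁ t₂ s₂ → t₂ :- t₁ :- (s₂ :- con (+ 1)) := (t₂ :- t₁) :+ (con (+ 1) :- s₂)) refl t₁ t₂ s₂))

  -- The factor `t₁` is an unclamped radius and may exceed 1; in that case `s₂ ≤ 1 ≤ s₁` and the
  -- left side is not positive.
  t₁*clamp-nonexpansive : ∀ {t₁ t₂ s₁ s₂} → t₁ ≤ t₂ → Clamp t₁ s₁ → Clamp t₂ s₂ →
    t₁ * (s₂ - s₁) ≤ t₂ - t₁
  t₁*clamp-nonexpansive {t₁} {t₂} {s₁} {s₂} t₁≤t₂ c₁ c₂ with total t₁ 1#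
  ... | inj₁ t₁≤1 = ≤-trans (≤-by (gap t₁≤1 ⊛ gap (clamp-mono t₁≤t₂ c₁ c₂))
      (solve 2 (λ t s → s :- t :* s := (con (+ 1) :- t) :* s) refl t₁ (s₂ - s₁))) (clamp-nonexpansive t₁≤t₂ c₁ c₂)
  ... | inj₂ 1≤t₁ = ≤-by (gap t₁≤t₂ ⊕ ≤-trans 0≤1 1≤t₁ ⊛ gap s₂≤s₁)
      (solve 4 (λ t₁ t₂ s₁ s₂ → t₂ :- t₁ :- t₁ :* (s₂ :- s₁) := (t₂ :- t₁) :+ t₁ :* (s₁ :- s₂)) refl t₁ t₂ s₁ s₂)
    where
    s₂≤s₁ : s₂ ≤ s₁
    s₂≤s₁ = ≤-trans (clamp≤1 c₂) (≥1 c₁)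
      where
      ≥1 : Clamp t₁ s₁ → 1# ≤ s₁
      ≥1 (inj₁ (_ , s₁≈t₁)) = ≤-respʳ-≈ (sym s₁≈t₁) 1≤t₁
      ≥1 (inj₂ (_ , s₁≈1))  = ≤-reflexive (sym s₁≈1)

  module Radii {s t : ℝ} (0≤s : 0# ≤ s) (s≤1 : s ≤ 1#) (0≤t : 0# ≤ t) (t≤1 : t ≤ 1#) (s≤t : s ≤ t) where

    private
      a = 1# - s * s
      b = 1# - t * t

      0≤1-x² : ∀ {x} → 0# ≤ x → x ≤ 1# → 0# ≤ 1# - x * x
      0≤1-x² {x} 0≤x x≤1 = ≤-respʳ-≈ (solve 1 (λ x → (con (+ 1) :- x) :* (con (+ 1) :+ x) := con (+ 1) :- x :* x) refl x)
        (gap x≤1 ⊛ (0≤1 ⊕ 0≤x))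

      1-x²≤1 : ∀ x → 1# - x * x ≤ 1#
      1-x²≤1 x = ≤-by (0≤x² x) (solve 1 (λ x → con (+ 1) :- (con (+ 1) :- x :* x) := x :* x) refl x)

      2x[1-x²]≤1 : ∀ {x} → 0# ≤ x → # 2 * (x * (1# - x * x)) ≤ 1#
      2x[1-x²]≤1 {x} 0≤x = ≤-by (0≤x² (1# - # 2 * x) ⊕ (0≤# 2 ⊛ 0≤x) ⊛ 0≤x² (1# - x))
        (solve 1 (λ x → con (+ 1) :- con (+ 2) :* (x :* (con (+ 1) :- x :* x))
          := (con (+ 1) :- con (+ 2) :* x) :* (con (+ 1) :- con (+ 2) :* x)
            :+ con (+ 2) :* x :* ((con (+ 1) :- x) :* (con (+ 1) :- x))) refl x)

      0≤a = 0≤1-x² 0≤s s≤1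
      0≤b = 0≤1-x² 0≤t t≤1
      a≤1 = 1-x²≤1 s
      b≤1 = 1-x²≤1 t

      sb+ta≤1 : s * b + t * a ≤ 1#
      sb+ta≤1 = ≤-by (0≤x² (1# - (s + t)) ⊕ (0≤s ⊕ 0≤t) ⊛ gap s≤1 ⊛ gap t≤1)
        (solve 2 (λ s t → con (+ 1) :- (s :* (con (+ 1) :- t :* t) :+ t :* (con (+ 1) :- s :* s))
          := (con (+ 1) :- (s :+ t)) :* (con (+ 1) :- (s :+ t)) :+ (s :+ t) :* ((con (+ 1) :- s) :* (con (+ 1) :- t))) refl s t)

    0≤b² : 0# ≤ b * b
    0≤b² = 0≤b ⊛ 0≤b

    b²≤1 : b * b ≤ 1#
    b²≤1 = ≤-by ((0≤1 ⊕ 0≤b) ⊛ gap b≤1) (solve 1 (λ b → con (+ 1) :- b :* b := (con (+ 1) :+ b) :* (con (+ 1) :- b)) refl b)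

    0≤a²-b² : 0# ≤ a * a - b * b
    0≤a²-b² = ≤-respʳ-≈ (solve 2 (λ s t → let a = con (+ 1) :- s :* s ; b = con (+ 1) :- t :* t in
        (t :- s) :* ((s :+ t) :* (a :+ b)) := a :* a :- b :* b) refl s t)
      (gap s≤t ⊛ (0≤s ⊕ 0≤t) ⊛ (0≤a ⊕ 0≤b))

    -- `a² - b² = (t - s)(s + t)(a + b)`, where `(s + t)(a + b) = sa + tb + (sb + ta)` is at most
    -- `1/2 + 1/2 + 1`.
    a²-b²≤ : a * a - b * b ≤ # 2 * (t - s)
    a²-b²≤ = ≤-by (0≤2x⇒0≤x (≤-respʳ-≈ (solve 2 (λ s t → let a = con (+ 1) :- s :* s ; b = con (+ 1) :- t :* t ; z = con (+ 2) :* (t :- s) :- (a :* a :- b :* b) in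
        (t :- s) :* ((con (+ 1) :- con (+ 2) :* (s :* a)) :+ ((con (+ 1) :- con (+ 2) :* (t :* b)) :+ con (+ 2) :* (con (+ 1) :- (s :* b :+ t :* a))))
        := z :+ z) refl s t)
      (gap s≤t ⊛ (gap (2x[1-x²]≤1 0≤s) ⊕ gap (2x[1-x²]≤1 0≤t) ⊕ 0≤# 2 ⊛ gap sb+ta≤1)))) refl

    0≤a³-b³ : 0# ≤ a * a * a - b * b * b
    0≤a³-b³ = ≤-respʳ-≈ (solve 2 (λ s t → let a = con (+ 1) :- s :* s ; b = con (+ 1) :- t :* t in
        (t :- s) :* ((s :+ t) :* (a :* a :+ (a :* b :+ b :* b))) := a :* a :* a :- b :* b :* b) refl s t)
      (gap s≤t ⊛ (0≤s ⊕ 0≤t) ⊛ (0≤a ⊛ 0≤a ⊕ 0≤a ⊛ 0≤b ⊕ 0≤b²))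

    -- (s + t)(a² + ab + b²) = (sa + tb)(a + b) + (sb² + ta²), where
    -- sa, tb ≤ 1/2 and sb² + ta² ≤ sb + ta ≤ 1.

    a³-b³≤ : a * a * a - b * b * b ≤ # 3 * (t - s)
    a³-b³≤ = ≤-by (0≤2x⇒0≤x (≤-respʳ-≈ (solve 2 (λ s t → let a = con (+ 1) :- s :* s ; b = con (+ 1) :- t :* t ; z = con (+ 3) :* (t :- s) :- (a :* a :* a :- b :* b :* b) in
        (t :- s) :* ((a :+ b) :* ((con (+ 1) :- con (+ 2) :* (s :* a)) :+ (con (+ 1) :- con (+ 2) :* (t :* b)))
          :+ (con (+ 2) :* ((con (+ 1) :- a) :+ (con (+ 1) :- b))
          :+ con (+ 2) :* ((con (+ 1) :- (s :* b :+ t :* a)) :+ ((s :* b) :* (con (+ 1) :- b) :+ (t :* a) :* (con (+ 1) :- a)))))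
        := z :+ z) refl s t)
      (gap s≤t ⊛ ((0≤a ⊕ 0≤b) ⊛ (gap (2x[1-x²]≤1 0≤s) ⊕ gap (2x[1-x²]≤1 0≤t)) ⊕ 0≤# 2 ⊛ (gap a≤1 ⊕ gap b≤1)
        ⊕ 0≤# 2 ⊛ (gap sb+ta≤1 ⊕ (0≤s ⊛ 0≤b) ⊛ gap b≤1 ⊕ (0≤t ⊛ 0≤a) ⊛ gap a≤1))))) refl

  module _ {d : ℕ} (c : ℝ^ d) where

    open Bump c

    -- Reduces the Lipschitz estimates to inequalities between two radii in [0, 1]: beyond distance
    -- 1 the bump is as flat as on the unit sphere.
    clampedRadius : ∀ x → ∃ λ s → Clamp ‖ x -ᵛ c ‖ s ∧ cap x ≈ 1# - s * s
    clampedRadius x with total ‖ x -ᵛ c ‖ 1#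
    ... | inj₁ n≤1 = ‖ x -ᵛ c ‖ , inj₁ (n≤1 , refl) , trans (0≤p⇒p⁺≈p (≤-respʳ-≈ (sym profile≈) 0≤1-n²)) profile≈
      where
      n = ‖ x -ᵛ c ‖
      profile≈ : profile x ≈ 1# - n * n
      profile≈ = +-congˡ (-‿cong (sym (‖x‖*‖x‖≈⟨x,x⟩ (x -ᵛ c))))
      0≤1-n² : 0# ≤ 1# - n * n
      0≤1-n² = ≤-respʳ-≈ (solve 1 (λ n → (con (+ 1) :- n) :* (con (+ 1) :+ n) := con (+ 1) :- n :* n) refl n)
        (gap n≤1 ⊛ (0≤1 ⊕ 0≤‖x‖ (x -ᵛ c)))
    ... | inj₂ 1≤n = 1# , inj₂ (1≤n , refl) , trans (p≤0⇒p⁺≈0 profile≤0)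
        (solve 0 (con (+ 0) := con (+ 1) :- con (+ 1) :* con (+ 1)) refl)
      where
      n = ‖ x -ᵛ c ‖
      profile≤0 : profile x ≤ 0#
      profile≤0 = ≤-by (gap 1≤n ⊛ (0≤1 ⊕ 0≤‖x‖ (x -ᵛ c)))
        (trans (+-congˡ (-‿cong (+-congˡ (-‿cong (sym (‖x‖*‖x‖≈⟨x,x⟩ (x -ᵛ c)))))))
          (solve 1 (λ n → con (+ 0) :- (con (+ 1) :- n :* n) := (n :- con (+ 1)) :* (con (+ 1) :+ n)) refl n))

    module _ {x y : ℝ^ d} (x≤y : ‖ x -ᵛ c ‖ ≤ ‖ y -ᵛ c ‖) where

      private
        v = x -ᵛ c
        w = y -ᵛ c
        n = ‖ y -ᵛ x ‖
        s = proj₁ (clampedRadius x)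
        t = proj₁ (clampedRadius y)
        cₛ = proj₁ (proj₂ (clampedRadius x))
        cₜ = proj₁ (proj₂ (clampedRadius y))
        a = 1# - s * s
        b = 1# - t * t
        P≈a = proj₂ (proj₂ (clampedRadius x))
        Q≈b = proj₂ (proj₂ (clampedRadius y))
        open Radii (0≤clamp (0≤‖x‖ v) cₛ) (clamp≤1 cₛ) (0≤clamp (0≤‖x‖ w) cₜ) (clamp≤1 cₜ) (clamp-mono x≤y cₛ cₜ)

        ‖w‖-‖v‖≤n : ‖ w ‖ - ‖ v ‖ ≤ n
        ‖w‖-‖v‖≤n = ≤-by (gap (‖-‖-triangle {x = v} {y -ᵛ x} {w}
            λ j → solve 3 (λ x y c → y :- c := x :- c :+ (y :- x)) refl (x j) (y j) (c j)))
          (solve 3 (λ V W n → n :- (W :- V) := V :+ n :- W) refl ‖ v ‖ ‖ w ‖ n)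

      -- The farther point `y` has the larger value, so only the upper bound has content: radially
      -- the slope is at most `3 · ⅓`, and the reverse triangle inequality compares radii with `n`.
      f-difference : Abs≤ (f y - f x) n
      f-difference = 0≤x≤b⇒Abs≤ (≤-respʳ-≈ (sym difference≈) (0≤⅓ ⊛ 0≤a³-b³))
        (≤-trans (≤-respˡ-≈ (sym difference≈) (≤-by (0≤⅓ ⊛ gap a³-b³≤)
          (trans (+-congʳ (trans (sym (*-identityˡ _)) (*-congʳ (sym 3*⅓≈1))))
            (solve 3 (λ k z e → con (+ 3) :* k :* z :- k :* e := k :* (con (+ 3) :* z :- e)) refl ⅓ (t - s) (a * a * a - b * b * b)))))
        (≤-trans (clamp-nonexpansive x≤y cₛ cₜ) ‖w‖-‖v‖≤n))
        where
        difference≈ : f y - f x ≈ ⅓ * (a * a * a - b * b * b)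
        difference≈ = trans (+-cong (-‿cong (*-congˡ (*-cong (*-cong Q≈b Q≈b) Q≈b)))
                                    (-‿cong (-‿cong (*-congˡ (*-cong (*-cong P≈a P≈a) P≈a)))))
          (solve 3 (λ k a b → :- (k :* (b :* b :* b)) :- :- (k :* (a :* a :* a)) := k :* (a :* a :* a :- b :* b :* b)) refl ⅓ a b)

      -- The difference is `2b²(y - x) - 2(a² - b²)v`. The first term contributes `2n`; the second
      -- at most `4(t - s)‖ v ‖ ≤ 4n`.
      ∇f-difference : ‖ ∇f y -ᵛ ∇f x ‖ ≤ # 6 * n
      ∇f-difference = ≤-trans (‖αx+βy‖≤
          (Abs≤-* (Abs≤-refl (0≤# 2)) (0≤x≤b⇒Abs≤ 0≤b² b²≤1))
          (Abs≤-neg (Abs≤-* (Abs≤-refl (0≤# 2)) (0≤x≤b⇒Abs≤ 0≤a²-b² a²-b²≤)))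
          difference≈)
        (≤-by (0≤# 4 ⊛ gap (≤-trans (t₁*clamp-nonexpansive x≤y cₛ cₜ) ‖w‖-‖v‖≤n))
          (solve 4 (λ n s t V → con (+ 6) :* n :- (con (+ 2) :* con (+ 1) :* n :+ con (+ 2) :* (con (+ 2) :* (t :- s)) :* V)
            := con (+ 4) :* (n :- V :* (t :- s))) refl n s t ‖ v ‖))
        where
        difference≈ : ∀ j → ∇f y j - ∇f x j ≈ # 2 * (b * b) * (y j - x j) + - (# 2 * (a * a - b * b)) * v j
        difference≈ j = trans (+-cong (*-congʳ (*-congˡ (*-cong Q≈b Q≈b))) (-‿cong (*-congʳ (*-congˡ (*-cong P≈a P≈a)))))
          (solve 5 (λ a b x y c → con (+ 2) :* (b :* b) :* (y :- c) :- con (+ 2) :* (a :* a) :* (x :- c)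
            := con (+ 2) :* (b :* b) :* (y :- x) :+ :- (con (+ 2) :* (a :* a :- b :* b)) :* (x :- c)) refl a b (x j) (y j) (c j))

    f-lipschitz : Lipschitz 1# f
    f-lipschitz x y with total ‖ x -ᵛ c ‖ ‖ y -ᵛ c ‖
    ... | inj₁ x≤y = ≤-respʳ-≈ (sym (*-identityˡ _)) (≤-trans
      (⊔-lub (≤-respˡ-≈ (solve 2 (λ p q → :- (q :- p) := p :- q) refl (f x) (f y)) (proj₂ (f-difference x≤y)))
               (≤-respˡ-≈ (solve 2 (λ p q → q :- p := :- (p :- q)) refl (f x) (f y)) (proj₁ (f-difference x≤y))))
      (‖x-y‖≤‖y-x‖ y x))
    ... | inj₂ y≤x = ≤-respʳ-≈ (sym (*-identityˡ _)) (⊔-lub (proj₁ (f-difference y≤x)) (proj₂ (f-difference y≤x)))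

    ∇f-lipschitz : Lipschitzᵛ (fromℕ 8) ∇f
    ∇f-lipschitz x y = ≤-trans 6-lipschitz (*-monoˡ (0≤‖x‖ (x -ᵛ y)) 6≤8)
      where
      6≤8 : # 6 ≤ fromℕ 8
      6≤8 = ≤-respʳ-≈ (sym (fromℕ≈# 8)) (#-mono {6} {8} (ℕ.m≤m+n 6 2))
      6-lipschitz : ‖ ∇f x -ᵛ ∇f y ‖ ≤ # 6 * ‖ x -ᵛ y ‖
      6-lipschitz with total ‖ x -ᵛ c ‖ ‖ y -ᵛ c ‖
      ... | inj₁ x≤y = ≤-trans (‖x-y‖≤‖y-x‖ (∇f x) (∇f y)) (≤-trans (∇f-difference x≤y)
        (≤-by (0≤# 6 ⊛ gap (‖x-y‖≤‖y-x‖ y x)) (solve 2 (λ p q → con (+ 6) :* p :- con (+ 6) :* q := con (+ 6) :* (p :- q)) refl _ _)))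
      ... | inj₂ y≤x = ∇f-difference y≤x

-- Grid points and a centre far from all given points

module Packing (em : ExcludedMiddle 0ℓ) (R : CompleteOrderedField) where

  open OrderedField em R
  open Euclidean em R
  open Words using (Letter; Word; match; agreements; ∃-distant-word)

  #-+ : ∀ m n → # (m ℕ.+ n) ≈ # m + # n
  #-+ m n = fromℤ-+ (+ m) (+ n)

  #-* : ∀ m n → # (m ℕ.* n) ≈ # m * # n
  #-* zero    n = sym (zeroˡ (# n))
  #-* (suc m) n = trans (#-+ n (m ℕ.* n)) (trans (+-congˡ (#-* m n))
    (trans (solve 2 (λ m n → n :+ m :* n := (con (+ 1) :+ m) :* n) refl (# m) (# n)) (*-congʳ (sym (#-+ 1 m)))))

  coordinate : Letter → ℝ
  coordinate k = # (toℕ k) - # 2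

  coordinate²≤4 : ∀ k → coordinate k * coordinate k ≤ # 4
  coordinate²≤4 k = ≤-by (0≤# (toℕ k) ⊛ gap (#-mono {toℕ k} {4} (toℕ≤pred[n] k)))
    (solve 1 (λ k → con (+ 4) :- (k :- con (+ 2)) :* (k :- con (+ 2)) := k :* (con (+ 4) :- k)) refl (# (toℕ k)))

  1≤[k-l]² : ∀ {k l} → k ℕ.< l → 1# ≤ (# k - # l) * (# k - # l)
  1≤[k-l]² {k} {l} k<l = ≤-by (0≤x² (# l - # k - 1#) ⊕ 0≤# 2 ⊛ gap 1+k≤l)
    (solve 2 (λ k l → (k :- l) :* (k :- l) :- con (+ 1)
      := (l :- k :- con (+ 1)) :* (l :- k :- con (+ 1)) :+ con (+ 2) :* (l :- (con (+ 1) :+ k))) refl (# k) (# l))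
    where
    1+k≤l : 1# + # k ≤ # l
    1+k≤l = ≤-respˡ-≈ (#-+ 1 k) (#-mono k<l)

  coordinate-distinct : ∀ {k l} → k ≢ l →
    1# ≤ (coordinate k - coordinate l) * (coordinate k - coordinate l)
  coordinate-distinct {k} {l} k≢l with ℕ.<-cmp (toℕ k) (toℕ l)
  ... | tri< k<l _ _ = ≤-respʳ-≈ (solve 2 (λ k l → (k :- l) :* (k :- l)
      := (k :- con (+ 2) :- (l :- con (+ 2))) :* (k :- con (+ 2) :- (l :- con (+ 2)))) refl (# (toℕ k)) (# (toℕ l))) (1≤[k-l]² k<l)
  ... | tri≈ _ k≡l _ = contradiction (toℕ-injective k≡l) k≢l
  ... | tri> _ _ l<k = ≤-respʳ-≈ (solve 2 (λ k l → (l :- k) :* (l :- k)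
      := (k :- con (+ 2) :- (l :- con (+ 2))) :* (k :- con (+ 2) :- (l :- con (+ 2)))) refl (# (toℕ k)) (# (toℕ l))) (1≤[k-l]² l<k)

  ⟨x,x⟩≤κd : ∀ {d κ} (x : ℝ^ d) → (∀ j → x j * x j ≤ κ) → ⟨ x , x ⟩ ≤ κ * # d
  ⟨x,x⟩≤κd {zero}  {κ} x x²≤κ = ≤-reflexive (sym (zeroʳ κ))
  ⟨x,x⟩≤κd {suc d} {κ} x x²≤κ = ≤-by (gap (x²≤κ zero) ⊕ gap (⟨x,x⟩≤κd (tail x) λ j → x²≤κ (suc j)))
    (trans (+-congʳ (*-congˡ (#-+ 1 d)))
      (solve 4 (λ κ d a X → κ :* (con (+ 1) :+ d) :- (a :+ X) := (κ :- a) :+ (κ :* d :- X)) refl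
        κ (# d) (head x * head x) ⟨ tail x , tail x ⟩))

  module _ (a : ℝ) where

    gridPoint : ∀ {d} → Word d → ℝ^ d
    gridPoint w j = a * coordinate (w j)

    coordinate-separation : ∀ k l → a * a * (1# - # (match k l)) ≤
      (a * coordinate k - a * coordinate l) * (a * coordinate k - a * coordinate l)
    coordinate-separation k l with k ≟ l
    ... | yes _   = ≤-by (0≤x² (a * coordinate k - a * coordinate l))
      (solve 2 (λ a x → x :- a :* (con (+ 1) :- con (+ 1)) := x) refl (a * a) _)
    ... | no  k≢l = ≤-by (0≤x² a ⊛ gap (coordinate-distinct k≢l))
      (solve 3 (λ a x y → (a :* x :- a :* y) :* (a :* x :- a :* y) :- a :* a :* (con (+ 1) :- con (+ 0))
        := a :* a :* ((x :- y) :* (x :- y) :- con (+ 1))) refl a (coordinate k) (coordinate l))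

    -- Every coordinate of disagreement contributes at least `a²`. Their number is formed in the
    -- field, avoiding truncated subtraction.
    gridPoint-separation : ∀ {d} (v w : Word d) → a * a * (# d - # (agreements v w)) ≤
      ⟨ gridPoint v -ᵛ gridPoint w , gridPoint v -ᵛ gridPoint w ⟩
    gridPoint-separation {zero}  v w = ≤-reflexive (solve 1 (λ a → a :* (con (+ 0) :- con (+ 0)) := con (+ 0)) refl (a * a))
    gridPoint-separation {suc d} v w =
      ≤-by (gap (coordinate-separation (head v) (head w)) ⊕ gap (gridPoint-separation (tail v) (tail w)))
        (trans (+-congˡ (-‿cong (*-congˡ (+-cong (#-+ 1 d) (-‿cong (#-+ (match (head v) (head w)) (agreements (tail v) (tail w))))))))
          (solve 6 (λ a d m g x X → x :+ X :- a :* (con (+ 1) :+ d :- (m :+ g))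
            := (x :- a :* (con (+ 1) :- m)) :+ (X :- a :* (d :- g))) refl
            (a * a) (# d) (# (match (head v) (head w))) (# (agreements (tail v) (tail w))) _ _))

  module Centres (d : ℕ) (d≥1 : d ≥ 1) where

    private
      1≤d : 1# ≤ # d
      1≤d = #-mono {1} d≥1

    scale : ℝ
    scale = √ (# 25 * # d ⁻¹)

    scale²*d≈25 : scale * scale * # d ≈ # 25
    scale²*d≈25 = trans (*-congʳ (√s*√s≈s (0≤# 25 ⊛ 0≤x⁻¹ 1≤d)))
      (trans (*-assoc _ _ _) (trans (*-congˡ (trans (*-comm _ _) (⁻¹-inverseʳ (# d) (1≤x⇒x≉0 1≤d)))) (*-identityʳ _)))

    centre : Word d → ℝ^ d
    centre = gridPoint scale

    centre∈B : ∀ w → centre w ∈ B 0ᵛ (fromℕ 10)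
    centre∈B w = ≤-respʳ-≈ (sym (fromℕ≈# 10)) (‖x‖≤ (centre w -ᵛ 0ᵛ) (0≤# 10) (≤-trans
      (⟨x,x⟩≤κd {κ = scale * scale * # 4} (centre w -ᵛ 0ᵛ) λ j → ≤-by (0≤x² scale ⊛ gap (coordinate²≤4 (w j)))
        (solve 2 (λ a x → a :* a :* con (+ 4) :- (a :* x :- con (+ 0)) :* (a :* x :- con (+ 0))
          := a :* a :* (con (+ 4) :- x :* x)) refl scale (coordinate (w j))))
      (≤-reflexive (trans (solve 2 (λ a d → a :* con (+ 4) :* d := a :* d :* con (+ 4)) refl (scale * scale) (# d))
        (trans (*-congʳ scale²*d≈25) (solve 0 (con (+ 25) :* con (+ 4) := con (+ 10) :* con (+ 10)) refl))))))

    -- The unit sphere counts as outside, since the bump and both derivatives vanish there too.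
    Outside : ℝ^ d → ℝ^ d → Set
    Outside c p = 1# ≤ ⟨ p -ᵛ c , p -ᵛ c ⟩

    ¬outside⇒≤1 : ∀ {c p} → ¬ Outside c p → ⟨ p -ᵛ c , p -ᵛ c ⟩ ≤ 1#
    ¬outside⇒≤1 {c} {p} ¬out with total 1# ⟨ p -ᵛ c , p -ᵛ c ⟩
    ... | inj₁ out = contradiction out ¬out
    ... | inj₂ ≤1  = ≤1

    -- The parallelogram bound puts the centres at squared distance at most `2(1 + 1) = 4`, so
    -- `a²(d - g) ≤ 4` for `g` agreements. Multiplying by `d` and using `a²d = 25` gives
    -- `25(d - g) ≤ 4d`.
    close⇒similar : ∀ v w {p} → ¬ Outside (centre v) p → ¬ Outside (centre w) p → 21 ℕ.* d ℕ.≤ 25 ℕ.* agreements v w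
    close⇒similar v w {p} v≈p w≈p = #-cancel-≤ (≤-respˡ-≈ (sym (#-* 21 d)) (≤-respʳ-≈ (sym (#-* 25 (agreements v w)))
      (≤-by (gap separation ⊛ 0≤# d)
        (trans (+-congʳ (trans (solve 3 (λ f d g → f :* g := f :* d :- f :* (d :- g)) refl (# 25) (# d) (# (agreements v w)))
            (+-congˡ (-‿cong (*-congʳ (sym scale²*d≈25))))))
          (solve 3 (λ a d g → con (+ 25) :* d :- a :* d :* (d :- g) :- con (+ 21) :* d
            := (con (+ 4) :- a :* (d :- g)) :* d) refl (scale * scale) (# d) (# (agreements v w)))))))
      where
      separation : scale * scale * (# d - # (agreements v w)) ≤ # 4
      separation = ≤-trans (gridPoint-separation scale v w) (≤-trans (parallelogram-≤ (centre v) (centre w) p)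
        (≤-by (0≤# 2 ⊛ (gap (¬outside⇒≤1 v≈p) ⊕ gap (¬outside⇒≤1 w≈p)))
          (solve 2 (λ x y → con (+ 4) :- con (+ 2) :* (x :+ y) := con (+ 2) :* ((con (+ 1) :- x) :+ (con (+ 1) :- y))) refl
            ⟨ p -ᵛ centre v , p -ᵛ centre v ⟩ ⟨ p -ᵛ centre w , p -ᵛ centre w ⟩)))

    -- One representative per point suffices, as all candidates near the point are similar to it.
    -- The zero word is a default for points with no candidate nearby.
    nearby : ℝ^ d → Word d
    nearby p with em {P = ∃ λ w → ¬ Outside (centre w) p}
    ... | yes (w , _) = w
    ... | no  _       = λ _ → zero

    nearby-close : ∀ p {w} → ¬ Outside (centre w) p → ¬ Outside (centre (nearby p)) p
    nearby-close p {w} w≈p with em {P = ∃ λ w → ¬ Outside (centre w) p}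
    ... | yes (_ , close) = close
    ... | no  none        = contradiction (w , w≈p) none

    ∃-centre-outside : (p : ℕ → ℝ^ d) → ∃ λ w → ∀ k → k ℕ.< 2 ^ d → Outside (centre w) (p k)
    ∃-centre-outside p = w , outside
      where
      instance
        d≢0 : NonZero d
        d≢0 = >-nonZero d≥1
      distant = ∃-distant-word d λ i → nearby (p (toℕ i))
      w = proj₁ distant
      -- A common near point requires agreement in 21/25 of the coordinates, while `w` agrees with
      -- each representative in fewer than 20/25.
      dissimilar : ∀ {v} → 5 ℕ.* agreements w v ℕ.< 4 ℕ.* d → ¬ 21 ℕ.* d ℕ.≤ 25 ℕ.* agreements w v
      dissimilar {v} 5g<4d 21d≤25g = ℕ.<⇒≱ (ℕ.*-monoʳ-< 5 5g<4d) (begin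
        5 ℕ.* (4 ℕ.* d)               ≡⟨ ℕ.*-assoc 5 4 d ⟨
        20 ℕ.* d                      ≤⟨ ℕ.*-monoˡ-≤ d (ℕ.m≤m+n 20 1) ⟩
        21 ℕ.* d                      ≤⟨ 21d≤25g ⟩
        25 ℕ.* agreements w v         ≡⟨ ℕ.*-assoc 5 5 (agreements w v) ⟩
        5 ℕ.* (5 ℕ.* agreements w v)  ∎)
        where open ℕ.≤-Reasoning
      outsideᶠ : ∀ i → Outside (centre w) (p (toℕ i))
      outsideᶠ i with em {P = Outside (centre w) (p (toℕ i))}
      ... | yes out = out
      ... | no ¬out = contradiction (close⇒similar w (nearby (p (toℕ i))) ¬out (nearby-close (p (toℕ i)) {w} ¬out))
                        (dissimilar (proj₂ distant i))
      outside : ∀ k → k ℕ.< 2 ^ d → Outside (centre w) (p k)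
      outside k k<2^d = ≡.subst (λ k → Outside (centre w) (p k)) (toℕ-fromℕ< k<2^d) (outsideᶠ (fromℕ< k<2^d))

-- The resisting oracle and the lower bound

module Resisting (em : ExcludedMiddle 0ℓ) (R : CompleteOrderedField)
  (d : ℕ) (d≥1 : d ≥ 1) (A : Reals.Algorithm R d) where

  open Words using (Word)
  open OrderedField em R
  open Euclidean em R
  open Bumps em R
  open BumpLipschitz em R
  open Packing em R
  open Centres d d≥1

  noInformation : Answer d
  noInformation = 0# , (λ _ → 0#) , (λ _ _ → 0#)

  -- An output is treated as a visited point just like a query, so the bump is kept away from both.
  location : ℝ^ d ⊎ ℝ^ d → ℝ^ d
  location = [ id , id ]′

  location-cong : ∀ {x y} → Setoid._≈_ (actionSetoid d) x y → ∀ j → location x j ≈ location y j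
  location-cong (inj₁ x≈y) = x≈y
  location-cong (inj₂ x≈y) = x≈y

  -- The points visited under all-zero answers. They depend on the algorithm alone, so the centre
  -- may be chosen afterwards. Past a stopping action the path merely lists further points to avoid.
  blindPath : ℕ → ℝ^ d
  blindPath k = location (Func.to A (List.replicate k noInformation))

  w : Word d
  w = proj₁ (∃-centre-outside blindPath)

  c : ℝ^ d
  c = centre w

  open Bump c

  bump : TwiceDifferentiable d
  bump = record { f = f ; ∇f = ∇f ; ∇²f = ∇²f ; isGradient = isGradient ; isHessian = isHessian }

  outside⇒cap≈0 : ∀ {x} → Outside c x → cap x ≈ 0#
  outside⇒cap≈0 {x} out = p≤0⇒p⁺≈0 (≤-by (gap out)
    (solve 1 (λ u → con (+ 0) :- (con (+ 1) :- u) := u :- con (+ 1)) refl ⟨ x -ᵛ c , x -ᵛ c ⟩))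

  cap≈0⇒f≈0 : ∀ {x} → cap x ≈ 0# → f x ≈ 0#
  cap≈0⇒f≈0 {x} P≈0 = trans (-‿cong (*-congˡ (*-congˡ P≈0)))
    (solve 2 (λ k P → :- (k :* (P :* P :* con (+ 0))) := con (+ 0)) refl ⅓ (cap x))

  outside⇒noInformation : ∀ {x} → Outside c x → Setoid._≈_ (answerSetoid d) (oracle A bump x) noInformation
  outside⇒noInformation {x} out =
    cap≈0⇒f≈0 P≈0 ,
    (λ i → trans (*-congʳ (*-congˡ (*-congˡ P≈0)))
      (solve 2 (λ P v → con (+ 2) :* (P :* con (+ 0)) :* v := con (+ 0)) refl (cap x) _)) ,
    (λ i j → trans (+-cong (*-congʳ (*-congˡ (*-congˡ P≈0))) (*-congʳ (-‿cong (*-congʳ (*-congˡ P≈0)))))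
      (solve 4 (λ P δ u v → con (+ 2) :* (P :* con (+ 0)) :* δ :+ (:- (con (+ 8) :* con (+ 0) :* u)) :* v := con (+ 0)) refl
        (cap x) (identityMatrix i j) _ _))
    where
    P≈0 = outside⇒cap≈0 out

  -- The answers equal zero only up to `≈`; since the algorithm respects this equality, its points
  -- agree with `blindPath` up to `≈`.
  blind : ∀ {h action} k → Pointwise (Setoid._≈_ (answerSetoid d)) h (List.replicate k noInformation) →
    Func.to A h ≡ action → k ℕ.< 2 ^ d → Outside c (location action)
  blind {h} k h≈ ≡.refl k<2^d = ≤-respʳ-≈
    (⟨⟩-cong (λ j → +-congʳ (sym (x≈ j))) (λ j → +-congʳ (sym (x≈ j))))
    (proj₂ (∃-centre-outside blindPath) k k<2^d)
    where
    x≈ : ∀ j → location (Func.to A h) j ≈ blindPath k j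
    x≈ = location-cong (Func.cong A h≈)

  -- A run with `n` further calls visits the points of index `k` to `k + n`, the last being the
  -- output; hence the strict bound. Each query lies outside the ball, so its answer extends the
  -- blind history.
  output-outside : ∀ {h x n} k → Pointwise (Setoid._≈_ (answerSetoid d)) h (List.replicate k noInformation) →
    k ℕ.+ n ℕ.< 2 ^ d → RunsFrom A bump h x n → Outside c x
  output-outside k h≈ k+0<2^d (stop eq) = blind k h≈ eq (≡.subst (ℕ._< 2 ^ d) (ℕ.+-identityʳ k) k+0<2^d)
  output-outside k h≈ k+1+n<2^d (call {n = n} eq run) =
    output-outside (suc k)
      (outside⇒noInformation (blind k h≈ eq (ℕ.≤-<-trans (ℕ.m≤m+n k (suc n)) k+1+n<2^d)) ∷ h≈)
      (≡.subst (ℕ._< 2 ^ d) (ℕ.+-suc k n) k+1+n<2^d) run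

  cap³≤1 : ∀ x → cap x * cap x * cap x ≤ 1#
  cap³≤1 x = ≤-by ((0≤1 ⊕ 0≤cap x ⊕ 0≤cap x ⊛ 0≤cap x) ⊛ gap (cap≤1 x))
    (solve 1 (λ P → con (+ 1) :- P :* P :* P := (con (+ 1) :+ (P :+ P :* P)) :* (con (+ 1) :- P)) refl (cap x))

  f[c]≈-⅓ : f c ≈ - ⅓
  f[c]≈-⅓ = trans (-‿cong (*-congˡ (*-cong (*-cong cap≈1 cap≈1) cap≈1)))
    (solve 1 (λ k → :- (k :* (con (+ 1) :* con (+ 1) :* con (+ 1))) := :- k) refl ⅓)
    where
    c-c≈0 : ⟨ c -ᵛ c , c -ᵛ c ⟩ ≈ 0#
    c-c≈0 = trans (⟨⟩-cong {y′ = c -ᵛ c} (λ j → -‿inverseʳ (c j)) (λ j → refl)) (⟨0,x⟩≈0 (c -ᵛ c))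
    profile≈1 : profile c ≈ 1#
    profile≈1 = trans (+-congˡ (-‿cong c-c≈0)) (solve 0 (con (+ 1) :- con (+ 0) := con (+ 1)) refl)
    cap≈1 : cap c ≈ 1#
    cap≈1 = trans (0≤p⇒p⁺≈p (≤-respʳ-≈ (sym profile≈1) 0≤1)) profile≈1

  c-minimizer : IsGlobalMinimizer f c
  c-minimizer y = ≤-respˡ-≈ (sym f[c]≈-⅓) (≤-by (0≤⅓ ⊛ gap (cap³≤1 y))
    (solve 2 (λ k z → :- (k :* z) :- :- k := k :* (con (+ 1) :- z)) refl ⅓ (cap y * cap y * cap y)))

  f≤0 : ∀ x → f x ≤ 0#
  f≤0 x = ≤-by (0≤⅓ ⊛ (0≤cap x ⊛ 0≤cap x) ⊛ 0≤cap x)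
    (solve 2 (λ k P → con (+ 0) :- :- (k :* (P :* P :* P)) := k :* (P :* P :* P)) refl ⅓ (cap x))

  0-isSup : IsSup _≤_ (Range f) 0#
  0-isSup = (λ { y (x , y≈fx) → ≤-respˡ-≈ (sym y≈fx) (f≤0 x) }) ,
    -- The value 0 is attained at the first blind point, available because `2 ^ d` is positive.
    λ b ub → ≤-respˡ-≈ (cap≈0⇒f≈0 (outside⇒cap≈0 (proj₂ (∃-centre-outside blindPath) 0 (ℕ.m^n>0 2 d))))
      (ub (f (blindPath 0)) (blindPath 0 , refl))

  f[c]-isInf : IsInf _≤_ (Range f) (f c)
  f[c]-isInf = (λ { y (x , y≈fx) → ≤-respʳ-≈ (sym y≈fx) (c-minimizer x) }) , λ b lb → lb (f c) (c , refl)

  1≤e : 1# ≤ e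
  1≤e = ≤-trans (#-mono {1} {2} (s≤s z≤n)) 2≤e

  -- The range has length exactly `⅓`, and `e ≤ 3`.
  range≤e⁻¹ : 0# - f c ≤ e ⁻¹
  range≤e⁻¹ = ≤-respˡ-≈ (trans (solve 1 (λ k → k := con (+ 0) :- :- k) refl ⅓) (+-congˡ (-‿cong (sym f[c]≈-⅓))))
    (y≤x⇒x⁻¹≤y⁻¹ 1≤e (≤-respʳ-≈ (sym (fromℕ≈# 3)) e≤3))

  -- Outside the ball the optimality gap is `⅓`. If this were at most `1/(2e)`, then `2e ≤ 3`,
  -- contrary to `2 ≤ e`.
  outside⇒¬½e-minimizer : ∀ {x} → Outside c x → ¬ f x - f c ≤ (fromℕ 2 * e) ⁻¹
  outside⇒¬½e-minimizer {x} out fx-fc≤ = contradiction (#-cancel-≤ {4} {3} (≤-trans 4≤2e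
    (≤-respʳ-≈ (fromℕ≈# 3) (x⁻¹≤y⁻¹⇒y≤x 1≤fromℕ3 1≤2e (≤-respˡ-≈ fx-fc≈⅓ fx-fc≤))))) (ℕ.<⇒≱ ℕ.≤-refl)
    where
    fx-fc≈⅓ : f x - f c ≈ ⅓
    fx-fc≈⅓ = trans (+-cong (cap≈0⇒f≈0 (outside⇒cap≈0 out)) (-‿cong f[c]≈-⅓))
      (solve 1 (λ k → con (+ 0) :- :- k := k) refl ⅓)
    4≤2e : # 4 ≤ fromℕ 2 * e
    4≤2e = ≤-respʳ-≈ (*-congʳ (sym (fromℕ≈# 2))) (≤-by (0≤# 2 ⊛ gap 2≤e)
      (solve 1 (λ e → con (+ 2) :* e :- con (+ 4) := con (+ 2) :* (e :- con (+ 2))) refl e))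
    1≤2e : 1# ≤ fromℕ 2 * e
    1≤2e = ≤-trans (#-mono {1} {4} (s≤s z≤n)) 4≤2e

theoremB1 : ExcludedMiddle 0ℓ → (R : CompleteOrderedField) →
    let open Reals R in
    (d : ℕ) → d ≥ 1 → (A : Algorithm d) →
    Σ (TwiceDifferentiable d) λ 𝔣 →
    let open TwiceDifferentiable 𝔣 in
    Lipschitz 1# f
    ∧ Lipschitzᵛ (fromℕ 8) ∇f
    ∧ (∃₂ λ M m → IsSup _≤_ (Range f) M ∧ IsInf _≤_ (Range f) m ∧ M - m ≤ e ⁻¹)
    ∧ (∃ λ x⋆ → x⋆ ∈ B 0ᵛ (fromℕ 10)
    ∧ IsGlobalMinimizer f x⋆
    ∧ (∀ n x° → OutputsAfter A 𝔣 n x° →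
    f x° - f x⋆ ≤ (fromℕ 2 * e) ⁻¹ → n ≥ 2 ^ d))
theoremB1 em R d d≥1 A =
  bump ,
  f-lipschitz c , ∇f-lipschitz c ,
  (0# , f c , 0-isSup , f[c]-isInf , range≤e⁻¹) ,
  (c , centre∈B w , c-minimizer , λ n x° run fx°-fc≤ → ℕ.≮⇒≥ λ n<2^d →
    outside⇒¬½e-minimizer (output-outside 0 [] n<2^d run) fx°-fc≤)
  where
  open Reals R
  open BumpLipschitz em R
  open Packing em R
  open Centres d d≥1
  open Resisting em R d d≥1 A
  open Bumps.Bump em R c using (f)
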